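{- Let $k\ge1$ be a fixed integer and $\rho\ge0$ an integer. Every connected graph $G$ with $n$ vertices and $\mathrm{tb}_k(G)\leq\rho$ admits an additive $(2\rho(1+\log_2 n))$-spanner with at most $O(kn\log n)$ edges, constructible in polynomial time (for every fixed $k$).
   Context: Graphs are finite, connected, unweighted, undirected and simple; $d_G$ is the shortest-path distance and $D_r(v,G)=\{u: d_G(u,v)\le r\}$. A tree-decomposition of $G=(V,E)$ is a pair $(\{X_i\mid i\in I\},T=(I,F))$ with $T$ a tree and bags $X_i\subseteq V$ such that (1) $\bigcup_i X_i=V$; (2) every edge lies in some bag; (3) for each $v\in V$ the nodes containing $v$ induce a connected subtree of $T$. Its $k$-breadth is the minimum integer $r$ such that every bag $X_i$ is contained in $D_r(v^i_1,G)\cup\dots\cup D_r(v^i_k,G)$ for some vertices $v^i_1,\dots,v^i_k$; $\mathrm{tb}_k(G)$ is the minimum $k$-breadth over all tree-decompositions of $G$. A spanning subgraph $H$ of $G$ is an additive $r$-spanner if $d_H(u,v)\le d_G(u,v)+r$ for all $u,v$. -}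

module Defs where

open import Data.Bool using (Bool; true; false; if_then_else_; _≟_)
open import Data.Fin using (Fin; _<?_)
open import Data.Fin.Subset using (Subset; _∈_)
open import Data.List using (List; []; _∷_; foldr; length; filter; tabulate; allFin; cartesianProduct)
open import Data.List.Membership.Propositional using () renaming (_∈_ to _∈ˡ_)
open import Data.List.Relation.Unary.All using (All; []; _∷_; lookup)
open import Data.List.Relation.Unary.Unique.Propositional using (Unique)
open import Data.Nat using (ℕ; suc; _+_; _*_; _^_; _≤_)
open import Data.Nat.Logarithm using (⌊log₂_⌋)
open import Data.Product using (Σ-syntax; ∃-syntax; _×_; _,_; proj₁; proj₂)
open import Data.Unit using (⊤; tt)
open import Relation.Binary.PropositionalEquality using (_≡_)
open import Relation.Nullary using (¬_)
open import Relation.Nullary.Decidable using (_×-dec_)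

IsMinimum : (ℕ → Set) → ℕ → Set
IsMinimum P m = P m × (∀ r → P r → m ≤ r)

record Graph (n : ℕ) : Set where
  field
    adj        : Fin n → Fin n → Bool
    adj-sym    : ∀ u v → adj u v ≡ adj v u
    adj-irrefl : ∀ u → adj u u ≡ false

  Adj : Fin n → Fin n → Set
  Adj u v = adj u v ≡ true

open Graph public

private variable
  n m : ℕ

infixr 5 _∷_

data Walk (G : Graph n) : Fin n → Fin n → ℕ → Set where
  []  : ∀ {u} → Walk G u u 0
  _∷_ : ∀ {u v w ℓ} → Adj G u v → Walk G v w ℓ → Walk G u w (suc ℓ)

vertices : {G : Graph n} {u v : Fin n} {ℓ : ℕ} → Walk G u v ℓ → List (Fin n)
vertices {u = u} []      = u ∷ []
vertices {u = u} (_ ∷ p) = u ∷ vertices p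

ConnectedOn : Graph n → (Fin n → Set) → Set
ConnectedOn G P = ∀ u v → P u → P v →
  ∃[ ℓ ] Σ[ p ∈ Walk G u v ℓ ] All P (vertices p)

Connected : Graph n → Set
Connected G = ConnectedOn G (λ _ → ⊤)

-- A simple path with at least three vertices, together with an edge joining
-- its two ends.
Cycle : Graph n → Set
Cycle G = ∃[ u ] ∃[ v ] ∃[ ℓ ] Σ[ p ∈ Walk G u v ℓ ]
  (Unique (vertices p) × 2 ≤ ℓ × Adj G v u)

IsTree : Graph n → Set
IsTree G = Connected G × ¬ Cycle G

-- Dist G u v d states d_G(u,v) = d; a shortest walk is a shortest path.
Dist : Graph n → Fin n → Fin n → ℕ → Set
Dist G u v = IsMinimum (Walk G u v)

_∈Disk[_,_]_ : Fin n → ℕ → Fin n → Graph n → Set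
u ∈Disk[ r , v ] G = ∃[ d ] (Dist G u v d × d ≤ r)

edges : Graph n → List (Fin n × Fin n)
edges {n} G = filter (λ (u , v) → (u <? v) ×-dec (adj G u v ≟ true))
                     (cartesianProduct (allFin n) (allFin n))

∣E_∣ : Graph n → ℕ
∣E G ∣ = length (edges G)

record AdditiveSpanner (r : ℕ) (G H : Graph n) : Set where
  field
    subgraph : ∀ u v → Adj H u v → Adj G u v
    stretch  : ∀ u v d → Dist G u v d → ∃[ d′ ] (Dist H u v d′ × d′ ≤ d + r)

-- ⌊ 2ρ(1 + log₂ n) ⌋ for n ≥ 1, because 2ρ log₂ n = log₂ (n ^ 2ρ).  As
-- distances are integers, taking the floor does not change which subgraphs
-- are additive spanners.
additiveError : (ρ n : ℕ) → ℕ
additiveError ρ n = 2 * ρ + ⌊log₂ (n ^ (2 * ρ)) ⌋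

record TreeDecomposition (G : Graph n) : Set where
  field
    {size}   : ℕ
    tree     : Graph size
    isTree   : IsTree tree
    bag      : Fin size → Subset n
    covers   : ∀ v → ∃[ i ] v ∈ bag i
    edge-bag : ∀ u v → Adj G u v → ∃[ i ] (u ∈ bag i × v ∈ bag i)
    subtree  : ∀ v → ConnectedOn tree (λ i → v ∈ bag i)

open TreeDecomposition public

CoveredByDisks : ℕ → {G : Graph n} → TreeDecomposition G → ℕ → Set
CoveredByDisks {n} k {G} D r = ∀ i → Σ[ c ∈ (Fin k → Fin n) ]
  (∀ u → u ∈ bag D i → ∃[ j ] u ∈Disk[ r , c j ] G)

IsBreadth : ℕ → {G : Graph n} → TreeDecomposition G → ℕ → Set
IsBreadth k D = IsMinimum (CoveredByDisks k D)

-- IsTreeBreadth k G t states tb_k(G) = t.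
IsTreeBreadth : ℕ → Graph n → ℕ → Set
IsTreeBreadth k G = IsMinimum (λ r → Σ[ D ∈ TreeDecomposition G ] IsBreadth k D r)

-- A computation model: a strict first-order functional language over booleans,
-- pairs and lists, with structural recursion on lists.  Every evaluated
-- subterm costs one unit, and each is a bounded number of pointer operations
-- on shared immutable cells.  A value of a fixed type built in t steps
-- unfolds to size polynomial in t and the input size, so polynomial cost
-- implies polynomial time on a Turing machine; conversely, a clocked machine
-- is simulated by a fold over a list of polynomial length.
infixr 6 _⊗_

data Ty : Set where
  bool : Ty
  _⊗_  : Ty → Ty → Ty
  list : Ty → Ty

⟦_⟧ : Ty → Set
⟦ bool ⟧   = Bool
⟦ σ ⊗ τ ⟧  = ⟦ σ ⟧ × ⟦ τ ⟧
⟦ list τ ⟧ = List ⟦ τ ⟧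

data Tm (Γ : List Ty) : Ty → Set where
  var        : ∀ {τ} → τ ∈ˡ Γ → Tm Γ τ
  let′       : ∀ {σ τ} → Tm Γ σ → Tm (σ ∷ Γ) τ → Tm Γ τ
  true false : Tm Γ bool
  if         : ∀ {τ} → Tm Γ bool → Tm Γ τ → Tm Γ τ → Tm Γ τ
  pair       : ∀ {σ τ} → Tm Γ σ → Tm Γ τ → Tm Γ (σ ⊗ τ)
  fst        : ∀ {σ τ} → Tm Γ (σ ⊗ τ) → Tm Γ σ
  snd        : ∀ {σ τ} → Tm Γ (σ ⊗ τ) → Tm Γ τ
  nil        : ∀ {τ} → Tm Γ (list τ)
  cons       : ∀ {τ} → Tm Γ τ → Tm Γ (list τ) → Tm Γ (list τ)
  case       : ∀ {σ τ} → Tm Γ (list σ) → Tm Γ τ → Tm (σ ∷ list σ ∷ Γ) τ → Tm Γ τ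
  fold       : ∀ {σ τ} → Tm Γ (list σ) → Tm Γ τ → Tm (σ ∷ τ ∷ Γ) τ → Tm Γ τ

Env : List Ty → Set
Env = All ⟦_⟧

eval : ∀ {Γ τ} → Tm Γ τ → Env Γ → ⟦ τ ⟧
eval (var x)      γ = lookup γ x
eval (let′ s t)   γ = eval t (eval s γ ∷ γ)
eval true         γ = true
eval false        γ = false
eval (if b s t)   γ = if eval b γ then eval s γ else eval t γ
eval (pair s t)   γ = eval s γ , eval t γ
eval (fst t)      γ = proj₁ (eval t γ)
eval (snd t)      γ = proj₂ (eval t γ)
eval nil          γ = []
eval (cons s t)   γ = eval s γ ∷ eval t γ
eval (case l z s) γ with eval l γ
... | []     = eval z γ
... | x ∷ xs = eval s (x ∷ xs ∷ γ)
eval (fold l z s) γ = foldr (λ x a → eval s (x ∷ a ∷ γ)) (eval z γ) (eval l γ)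

cost : ∀ {Γ τ} → Tm Γ τ → Env Γ → ℕ
foldCost : ∀ {Γ σ τ} → Tm (σ ∷ τ ∷ Γ) τ → Env Γ → ⟦ τ ⟧ → List ⟦ σ ⟧ → ℕ

cost (var x)      γ = 1
cost (let′ s t)   γ = 1 + cost s γ + cost t (eval s γ ∷ γ)
cost true         γ = 1
cost false        γ = 1
cost (if b s t)   γ = 1 + cost b γ + (if eval b γ then cost s γ else cost t γ)
cost (pair s t)   γ = 1 + cost s γ + cost t γ
cost (fst t)      γ = 1 + cost t γ
cost (snd t)      γ = 1 + cost t γ
cost nil          γ = 1
cost (cons s t)   γ = 1 + cost s γ + cost t γ
cost (case l z s) γ with eval l γ
... | []     = 1 + cost l γ + cost z γ
... | x ∷ xs = 1 + cost l γ + cost s (x ∷ xs ∷ γ)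
cost (fold l z s) γ = 1 + cost l γ + cost z γ + foldCost s γ (eval z γ) (eval l γ)

foldCost s γ z []       = 0
foldCost s γ z (x ∷ xs) =
  1 + foldCost s γ z xs
    + cost s (x ∷ foldr (λ y a → eval s (y ∷ a ∷ γ)) z xs ∷ γ)

-- Graphs are given to and returned by programs as adjacency matrices.
matrix : Graph n → List (List Bool)
matrix G = tabulate (λ u → tabulate (λ v → adj G u v))

Program : Set
Program = Tm (list (list bool) ∷ []) (list (list bool))

output : Program → Graph n → List (List Bool)
output P G = eval P (matrix G ∷ [])

time : Program → Graph n → ℕ
time P G = cost P (matrix G ∷ [])

{-# OPTIONS --safe #-}
-- Every vertex set C has a balanced separator consisting of k disks: send each
-- node of the tree-decomposition whose bag leaves a component of G[C] with more
-- than half of C to the neighbouring node behind which that component lies.  In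
-- a finite tree two adjacent nodes then point at each other, although two
-- components of more than |C|/2 vertices cannot be disjoint.
--
-- Starting from all vertices, every round finds, by exhaustive search, a
-- balanced separator of smallest radius for each component C of the active
-- vertices, joins each u ∈ C to a neighbour in G that is nearest to c, for each
-- of the k centres c, and deactivates the vertices in the disks.  Components
-- halve, so at most 1 + log₂ n rounds are active and each adds at most kn
-- edges.  A walk that meets a disk is rerouted through its centre at a price of
-- 2ρ; if the edges towards the centre leave C, the rerouted walk meets a vertex
-- deactivated earlier, so the price is paid at most once per round.
--
-- The algorithm is written in a small language over vertices and arrays indexed
-- by vertices.  All arrays have length n and all loops run over vertices, so
-- every expression compiles to a program of polynomial cost.
module Submission where

import Data.Bool as Bool
import Data.Fin as F
import Data.List.Relation.Unary.All as All
import Data.List.Relation.Unary.Any as Any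
import Data.List.Relation.Unary.Unique.Propositional.Properties as Unique
open import Data.Bool using (Bool; true; false; if_then_else_)
open import Data.Bool.Properties using (T-≡; ¬-not)
open import Data.Empty using (⊥; ⊥-elim)
open import Data.Fin using (Fin; zero; suc; toℕ; fromℕ<)
open import Data.Fin.Properties using (toℕ<n; toℕ-injective; toℕ-fromℕ<; any?; all?; ¬∀⟶∃¬)
open import Data.Fin.Subset using () renaming (_∈_ to _∈ˢ_; _∉_ to _∉ˢ_)
open import Data.Fin.Subset.Properties using () renaming (_∈?_ to _∈ˢ?_)
open import Data.List using (List; []; _∷_; _++_; foldr; length; tabulate; allFin; replicate; drop; map; concatMap; upTo; cartesianProduct)
open import Data.List.Membership.Propositional using (lose) renaming (_∈_ to _∈ˡ_)
open import Data.List.Membership.Propositional.Properties using (∈-∃++; ∈-++⁻; ∈-++⁺ˡ; ∈-++⁺ʳ; ∈-allFin; ∈-map⁺; ∈-map⁻; ∈-concatMap⁺; ∈-upTo⁺; ∈-filter⁻)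
open import Data.List.Properties using (map-tabulate; tabulate-cong; length-map; length-tabulate; length-replicate; length-++; length-upTo; map-∘)
open import Data.List.Relation.Unary.All using (All; []; _∷_; lookup; universal)
open import Data.List.Relation.Unary.All.Properties using (map⁺; ¬Any⇒All¬)
open import Data.List.Relation.Unary.AllPairs using ([]; _∷_)
open import Data.List.Relation.Unary.Any using (here; there)
open import Data.List.Relation.Unary.Unique.Propositional using (Unique)
open import Data.Nat using (ℕ; zero; suc; _+_; _*_; _∸_; _^_; _⊓_; _≤_; _<_; _≤?_; _≤ᵇ_; z≤n; s≤s; s≤s⁻¹; NonZero; ⌊_/2⌋; ⌈_/2⌉)
open import Data.Nat.Induction using (<-rec)
open import Data.Nat.Logarithm using (⌊log₂_⌋; ⌊log₂⌋-mono-≤; ⌊log₂[2^n]⌋≡n; ⌊log₂⌊n/2⌋⌋≡⌊log₂n⌋∸1)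
open import Data.Nat.Properties
open import Algebra.Properties.CommutativeSemigroup +-commutativeSemigroup using (interchange)
open import Data.Product using (Σ-syntax; ∃-syntax; _×_; _,_; proj₁; proj₂; swap)
open import Data.Sum using (_⊎_; inj₁; inj₂)
open import Data.Unit using (⊤; tt)
open import Function using (_∘_; id)
open import Function.Bundles using (Equivalence)
open import Relation.Binary.PropositionalEquality
open import Relation.Nullary using (¬_)
open import Relation.Nullary.Decidable using (Dec; ⌊_⌋; yes; no; _×-dec_)
open import Defs

-- An array language over vertices and its semantics.

infixr 6 _⊗_

data Type : Set where
  bool vert : Type
  arr       : Type → Type
  _⊗_       : Type → Type → Type

-- A vertex also serves as a number below n, the number of steps of `times`. No expression builds a
-- larger number, so every loop runs at most n times. A `call` hands its body one argument and no
-- other variable, so functions compose without renaming.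
data Exp (Γ : List Type) : Type → Set where
  var        : ∀ {τ} → τ ∈ˡ Γ → Exp Γ τ
  call       : ∀ {σ τ} → Exp (σ ∷ []) τ → Exp Γ σ → Exp Γ τ
  true false : Exp Γ bool
  if         : ∀ {τ} → Exp Γ bool → Exp Γ τ → Exp Γ τ → Exp Γ τ
  pair       : ∀ {σ τ} → Exp Γ σ → Exp Γ τ → Exp Γ (σ ⊗ τ)
  fst        : ∀ {σ τ} → Exp Γ (σ ⊗ τ) → Exp Γ σ
  snd        : ∀ {σ τ} → Exp Γ (σ ⊗ τ) → Exp Γ τ
  first      : Exp Γ vert
  edge equal : Exp Γ vert → Exp Γ vert → Exp Γ bool
  half       : Exp Γ (arr bool) → Exp Γ (arr bool) → Exp Γ bool
  tab        : ∀ {τ} → Exp (vert ∷ Γ) τ → Exp Γ (arr τ)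
  index      : ∀ {τ} → Exp Γ (arr τ) → Exp Γ vert → Exp Γ τ
  times      : ∀ {τ} → Exp Γ vert → Exp Γ τ → Exp (τ ∷ Γ) τ → Exp Γ τ
  loop       : ∀ {τ} → Exp Γ τ → Exp (vert ∷ τ ∷ Γ) τ → Exp Γ τ

variable
  m n : ℕ
  Γ : List Type
  Δ : List Ty
  σ τ : Type

-- Vertices are `Fin (suc m)`, so that `first` has a value.
Val : ℕ → Type → Set
Val m bool    = Bool
Val m vert    = Fin (suc m)
Val m (arr τ) = Fin (suc m) → Val m τ
Val m (σ ⊗ τ) = Val m σ × Val m τ

Vals : ℕ → List Type → Set
Vals m = All (Val m)

repeat : ∀ {A : Set} → ℕ → (A → A) → A → A
repeat zero    f z = z
repeat (suc k) f z = f (repeat k f z)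

count : (Fin n → Bool) → ℕ
count {zero}  X = 0
count {suc n} X = (if X zero then 1 else 0) + count (X ∘ suc)

⟪_⟫ : Exp Γ τ → Graph (suc m) → Vals m Γ → Val m τ
⟪ var x ⟫      G γ = lookup γ x
⟪ call f e ⟫   G γ = ⟪ f ⟫ G (⟪ e ⟫ G γ ∷ [])
⟪ true ⟫       G γ = true
⟪ false ⟫      G γ = false
⟪ if b s t ⟫   G γ = if ⟪ b ⟫ G γ then ⟪ s ⟫ G γ else ⟪ t ⟫ G γ
⟪ pair s t ⟫   G γ = ⟪ s ⟫ G γ , ⟪ t ⟫ G γ
⟪ fst t ⟫      G γ = proj₁ (⟪ t ⟫ G γ)
⟪ snd t ⟫      G γ = proj₂ (⟪ t ⟫ G γ)
⟪ first ⟫      G γ = zero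
⟪ edge u v ⟫   G γ = adj G (⟪ u ⟫ G γ) (⟪ v ⟫ G γ)
⟪ equal u v ⟫  G γ = ⌊ ⟪ u ⟫ G γ F.≟ ⟪ v ⟫ G γ ⌋
⟪ half X Y ⟫   G γ = 2 * count (⟪ X ⟫ G γ) ≤ᵇ count (⟪ Y ⟫ G γ)
⟪ tab e ⟫      G γ = λ v → ⟪ e ⟫ G (v ∷ γ)
⟪ index a v ⟫  G γ = ⟪ a ⟫ G γ (⟪ v ⟫ G γ)
⟪ times v z s ⟫ G γ = repeat (toℕ (⟪ v ⟫ G γ)) (λ a → ⟪ s ⟫ G (a ∷ γ)) (⟪ z ⟫ G γ)
⟪ loop z s ⟫   G γ = foldr (λ v a → ⟪ s ⟫ G (v ∷ a ∷ γ)) (⟪ z ⟫ G γ) (allFin _)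

-- Translation into the computation model.

tr : Type → Ty
tr bool    = bool
tr vert    = list bool
tr (arr τ) = list (tr τ)
tr (σ ⊗ τ) = tr σ ⊗ tr τ

-- Vertex i is represented in unary, so that a fold over it iterates i times.
code : Fin n → List Bool
code i = replicate (toℕ i) true

codes : ∀ n → List (List Bool)
codes n = map code (allFin n)

enc : Val m τ → ⟦ tr τ ⟧
enc {τ = bool}  b       = b
enc {τ = vert}  v       = code v
enc {τ = arr τ} f       = tabulate (λ v → enc {τ = τ} (f v))
enc {τ = σ ⊗ τ} (x , y) = enc {τ = σ} x , enc {τ = τ} y

-- Besides the variables Γ, the context of compiled code holds the input, the
-- list of all vertices, and accumulators of enclosing folds.
record Layout (Γ : List Type) (Δ : List Ty) : Set where
  field
    matrix∈ : list (list bool) ∈ˡ Δ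
    codes∈  : list (list bool) ∈ˡ Δ
    place   : ∀ {τ} → τ ∈ˡ Γ → tr τ ∈ˡ Δ

open Layout

bind : Layout Γ Δ → Layout (τ ∷ Γ) (tr τ ∷ Δ)
bind L .matrix∈          = there (matrix∈ L)
bind L .codes∈           = there (codes∈ L)
bind L .place (here refl) = here refl
bind L .place (there x)  = there (place L x)

skip : ∀ {ν} → Layout Γ Δ → Layout Γ (ν ∷ Δ)
skip L .matrix∈ = there (matrix∈ L)
skip L .codes∈  = there (codes∈ L)
skip L .place x = there (place L x)

forget : Layout Γ Δ → Layout [] Δ
forget L .matrix∈ = matrix∈ L
forget L .codes∈  = codes∈ L
forget L .place ()

#0 : ∀ {A : Set} {x : A} {xs} → x ∈ˡ x ∷ xs
#0 = here refl

#1 : ∀ {A : Set} {x y : A} {xs} → x ∈ˡ y ∷ x ∷ xs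
#1 = there (here refl)

#2 : ∀ {A : Set} {x y z : A} {xs} → x ∈ˡ y ∷ z ∷ x ∷ xs
#2 = there (there (here refl))

-- Fills the out-of-range branch of `atᵗ`, which no compiled expression reaches: arrays have one
-- entry per vertex.
default : ∀ ν → Tm Δ ν
default bool     = false
default (ν ⊗ ν′) = pair (default ν) (default ν′)
default (list ν) = nil

tailᵗ : ∀ {ν} → Tm Δ (list ν) → Tm Δ (list ν)
tailᵗ xs = case xs nil (var #1)

tail₁ : ∀ {ν} → Tm (bool ∷ list ν ∷ Δ) (list ν)
tail₁ = tailᵗ (var #1)

dropᵗ : ∀ {ν} → Tm Δ (list bool) → Tm Δ (list ν) → Tm Δ (list ν)
dropᵗ k xs = fold k xs tail₁

atᵗ : ∀ {ν} → Tm Δ (list ν) → Tm Δ (list bool) → Tm Δ ν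
atᵗ xs k = case (dropᵗ k xs) (default _) (var #0)

-- Dropping one unary number from another computes a truncated difference; the numbers are equal
-- when both differences vanish.
equalᵗ : Tm Δ (list bool) → Tm Δ (list bool) → Tm Δ bool
equalᵗ u v = case (dropᵗ u v) (case (dropᵗ v u) true false) false

truesᵗ : Tm Δ (list bool) → Tm Δ (list bool)
truesᵗ X = fold X nil (if (var #0) (cons true (var #1)) (var #1))

remove₂ : Tm (bool ∷ list bool ∷ Δ) (list bool)
remove₂ = if (var #0) (tailᵗ tail₁) (var #1)

-- The list that elements are removed from has length |Y| + 1, so that it is
-- exhausted if and only if 2|X| > |Y|.
halfᵗ : Tm Δ (list bool) → Tm Δ (list bool) → Tm Δ bool
halfᵗ X Y =
  case (fold X (cons true (truesᵗ Y)) remove₂) false true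

compile : Layout Γ Δ → Exp Γ τ → Tm Δ (tr τ)
compile L (var x)     = var (place L x)
compile L (call f e)  = let′ (compile L e) (compile (bind (forget L)) f)
compile L true        = true
compile L false       = false
compile L (if b s t)  = if (compile L b) (compile L s) (compile L t)
compile L (pair s t)  = pair (compile L s) (compile L t)
compile L (fst t)     = fst (compile L t)
compile L (snd t)     = snd (compile L t)
compile L first       = nil
compile L (edge u v)  = atᵗ (atᵗ (var (matrix∈ L)) (compile L u)) (compile L v)
compile L (equal u v) = equalᵗ (compile L u) (compile L v)
compile L (half X Y)  = halfᵗ (compile L X) (compile L Y)
-- In the body of a fold the list element lies above the accumulator: `tab` binds only the former,
-- `times` only the latter, `loop` both.
compile L (tab e)     = fold (var (codes∈ L)) nil (cons (compile (bind (skip L)) e) (var #1))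
compile L (index a v) = atᵗ (compile L a) (compile L v)
compile L (times v z s) = fold (compile L v) (compile L z) (compile (skip (bind L)) s)
compile L (loop z s)  = fold (var (codes∈ L)) (compile L z) (compile (bind (bind L)) s)

-- Correctness of compiled code.

record Represents (L : Layout Γ Δ) (G : Graph (suc m)) (γ : Vals m Γ) (δ : Env Δ) : Set where
  field
    matrix≡ : lookup δ (matrix∈ L) ≡ matrix G
    codes≡  : lookup δ (codes∈ L) ≡ codes (suc m)
    place≡  : ∀ {τ} (x : τ ∈ˡ Γ) → lookup δ (place L x) ≡ enc {τ = τ} (lookup γ x)

open Represents

module _ {L : Layout Γ Δ} {G : Graph (suc m)} {γ : Vals m Γ} {δ : Env Δ}
         (R : Represents L G γ δ) where

  bind≡ : {x : ⟦ tr τ ⟧} {v : Val m τ} → x ≡ enc {τ = τ} v →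
          Represents (bind {τ = τ} L) G (v ∷ γ) (x ∷ δ)
  bind≡ e .matrix≡            = matrix≡ R
  bind≡ e .codes≡             = codes≡ R
  bind≡ e .place≡ (here refl) = e
  bind≡ e .place≡ (there x)   = place≡ R x

  skip≡ : ∀ {ν} {x : ⟦ ν ⟧} → Represents (skip {ν = ν} L) G γ (x ∷ δ)
  skip≡ .matrix≡  = matrix≡ R
  skip≡ .codes≡   = codes≡ R
  skip≡ .place≡ x = place≡ R x

  forget≡ : Represents (forget L) G [] δ
  forget≡ .matrix≡ = matrix≡ R
  forget≡ .codes≡  = codes≡ R
  forget≡ .place≡ ()

eval-drop : ∀ {ν} (k : Tm Δ (list bool)) (xs : Tm Δ (list ν)) (δ : Env Δ) {i : Fin n} →
            eval k δ ≡ code i → eval (dropᵗ k xs) δ ≡ drop (toℕ i) (eval xs δ)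
eval-drop {ν = ν} k xs δ {i} e rewrite e = go (toℕ i) (eval xs δ)
  where
  tail-drop : ∀ j (ys : List ⟦ ν ⟧) → eval tail₁ (true ∷ drop j ys ∷ δ) ≡ drop (suc j) ys
  tail-drop zero    []       = refl
  tail-drop zero    (y ∷ ys) = refl
  tail-drop (suc j) []       = refl
  tail-drop (suc j) (y ∷ ys) = tail-drop j ys

  go : ∀ j (ys : List ⟦ ν ⟧) →
       foldr (λ (x : Bool) (a : List ⟦ ν ⟧) → eval (tail₁ {ν = ν}) (x ∷ a ∷ δ)) ys (replicate j true)
       ≡ drop j ys
  go zero    ys = refl
  go (suc j) ys = trans (cong (λ a → eval (tail₁ {ν = ν}) (true ∷ a ∷ δ)) (go j ys)) (tail-drop j ys)

drop-tabulate : ∀ {A : Set} (f : Fin n → A) i →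
                drop (toℕ i) (tabulate f) ≡ f i ∷ drop (suc (toℕ i)) (tabulate f)
drop-tabulate f zero    = refl
drop-tabulate f (suc i) = drop-tabulate (f ∘ suc) i

module _ {μ ν : Ty} (l : Tm Δ (list μ)) {z : Tm Δ ν} {s : Tm (μ ∷ list μ ∷ Δ) ν} (δ : Env Δ) where

  eval-case-[] : eval l δ ≡ [] → eval (case l z s) δ ≡ eval z δ
  eval-case-[] e rewrite e = refl

  eval-case-∷ : ∀ {x xs} → eval l δ ≡ x ∷ xs → eval (case l z s) δ ≡ eval s (x ∷ xs ∷ δ)
  eval-case-∷ e rewrite e = refl

eval-at : ∀ {ν} (xs : Tm Δ (list ν)) (k : Tm Δ (list bool)) (δ : Env Δ)
          {f : Fin n → ⟦ ν ⟧} {i : Fin n} →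
          eval xs δ ≡ tabulate f → eval k δ ≡ code i → eval (atᵗ xs k) δ ≡ f i
eval-at xs k δ {f} {i} ef ei = eval-case-∷ (dropᵗ k xs) δ
  (trans (eval-drop k xs δ {i} ei) (trans (cong (drop (toℕ i)) ef) (drop-tabulate f i)))

drop-replicate : ∀ {A : Set} {x : A} k l → drop k (replicate l x) ≡ replicate (l ∸ k) x
drop-replicate zero    l       = refl
drop-replicate (suc k) zero    = refl
drop-replicate (suc k) (suc l) = drop-replicate k l

eval-equal : (u v : Tm Δ (list bool)) (δ : Env Δ) {i j : Fin n} →
             eval u δ ≡ code i → eval v δ ≡ code j → eval (equalᵗ u v) δ ≡ ⌊ i F.≟ j ⌋
eval-equal u v δ {i} {j} eu ev = go (i F.≟ j)
  where
  monus : ∀ {i j : Fin _} u v → eval u δ ≡ code i → eval v δ ≡ code j →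
          eval (dropᵗ u v) δ ≡ replicate (toℕ j ∸ toℕ i) true
  monus {i} {j} u v eu ev = trans (eval-drop u v δ {i} eu)
    (trans (cong (drop (toℕ i)) ev) (drop-replicate (toℕ i) (toℕ j)))

  u-v : eval (dropᵗ v u) δ ≡ replicate (toℕ i ∸ toℕ j) true
  u-v = monus v u ev eu

  v-u : eval (dropᵗ u v) δ ≡ replicate (toℕ j ∸ toℕ i) true
  v-u = monus u v eu ev

  go : (i≟j : Dec (i ≡ j)) → eval (equalᵗ u v) δ ≡ ⌊ i≟j ⌋
  go (yes refl) =
    trans (eval-case-[] (dropᵗ u v) δ (trans v-u none)) (eval-case-[] (dropᵗ v u) δ (trans u-v none))
    where
    none : replicate (toℕ i ∸ toℕ i) true ≡ []
    none = cong (λ k → replicate k true) (n∸n≡0 (toℕ i))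
  go (no i≢j) with toℕ j ∸ toℕ i in j∸i | v-u
  ... | suc _ | e = eval-case-∷ (dropᵗ u v) δ e
  ... | zero  | e with toℕ i ∸ toℕ j in i∸j | u-v
  ...   | suc _ | e′ = trans (eval-case-[] (dropᵗ u v) δ e) (eval-case-∷ (dropᵗ v u) δ e′)
  -- Both truncated differences vanish only if i ≤ j and j ≤ i.
  ...   | zero  | _  = ⊥-elim (i≢j (toℕ-injective
    (≤-antisym (m∸n≡0⇒m≤n {toℕ i} i∸j) (m∸n≡0⇒m≤n {toℕ j} j∸i))))

eval-trues : (X : Tm Δ (list bool)) (δ : Env Δ) {f : Fin n → Bool} →
             eval X δ ≡ tabulate f → eval (truesᵗ X) δ ≡ replicate (count f) true
eval-trues X δ {f} e rewrite e = go f
  where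
  go : ∀ {n} (f : Fin n → Bool) →
       foldr (λ x a → if x then true ∷ a else a) [] (tabulate f) ≡ replicate (count f) true
  go {zero}  f = refl
  go {suc n} f with f zero
  ... | true  = cong (true ∷_) (go (f ∘ suc))
  ... | false = go (f ∘ suc)

module _ (δ : Env Δ) where

  eval-tail² : ∀ l → eval remove₂ (true ∷ replicate l true ∷ δ) ≡ replicate (l ∸ 2) true
  eval-tail² zero          = refl
  eval-tail² (suc zero)    = refl
  eval-tail² (suc (suc l)) = refl

  -- The tail of an exhausted list and truncated subtraction both stop at zero, so the two sides
  -- agree for every `l`.
  eval-remove : ∀ {n} (f : Fin n → Bool) l →
    foldr (λ x a → eval remove₂ (x ∷ a ∷ δ)) (replicate l true) (tabulate f)
    ≡ replicate (l ∸ 2 * count f) true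
  eval-remove {zero}  f l = refl
  eval-remove {suc n} f l with f zero
  ... | false rewrite eval-remove (f ∘ suc) l = refl
  ... | true  rewrite eval-remove (f ∘ suc) l | eval-tail² (l ∸ 2 * count (f ∘ suc))
    = cong (λ k → replicate k true) (trans (∸-+-assoc l (2 * count (f ∘ suc)) 2)
        (cong (l ∸_) (trans (+-comm (2 * count (f ∘ suc)) 2)
          (sym (*-suc 2 (count (f ∘ suc)))))))

eval-half : (X Y : Tm Δ (list bool)) (δ : Env Δ) {f g : Fin n → Bool} →
            eval X δ ≡ tabulate f → eval Y δ ≡ tabulate g →
            eval (halfᵗ X Y) δ ≡ (2 * count f ≤ᵇ count g)
eval-half {Δ} X Y δ {f} {g} eX eY = go (2 * count f ≤? count g)
  where
  removed : Tm Δ (list bool)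
  removed = fold X (cons true (truesᵗ Y)) remove₂

  e : eval removed δ ≡ replicate (suc (count g) ∸ 2 * count f) true
  e rewrite eX | eval-trues Y δ {g} eY = eval-remove δ f (suc (count g))

  go : Dec (2 * count f ≤ count g) → eval (halfᵗ X Y) δ ≡ (2 * count f ≤ᵇ count g)
  go (yes p) = trans (eval-case-∷ removed δ (trans e (cong (λ k → replicate k true) (+-∸-assoc 1 p))))
                     (sym (Equivalence.to T-≡ (≤⇒≤ᵇ p)))
  go (no p)  = trans (eval-case-[] removed δ (trans e (cong (λ k → replicate k true) (m≤n⇒m∸n≡0 (≰⇒> p)))))
                     (sym (¬-not (λ q → p (≤ᵇ⇒≤ _ _ (Equivalence.from T-≡ q)))))

compile-correct : {L : Layout Γ Δ} {G : Graph (suc m)} {γ : Vals m Γ} {δ : Env Δ} →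
                  Represents L G γ δ → (e : Exp Γ τ) →
                  eval (compile L e) δ ≡ enc {τ = τ} (⟪ e ⟫ G γ)
compile-correct R (var x)    = place≡ R x
compile-correct R (call f e) = compile-correct (bind≡ (forget≡ R) (compile-correct R e)) f
compile-correct R true       = refl
compile-correct R false      = refl
compile-correct {L = L} {G} {γ} R (if b s t) rewrite compile-correct R b with ⟪ b ⟫ G γ
... | true  = compile-correct R s
... | false = compile-correct R t
compile-correct R (pair s t)  = cong₂ _,_ (compile-correct R s) (compile-correct R t)
compile-correct R (fst t)     = cong proj₁ (compile-correct R t)
compile-correct R (snd t)     = cong proj₂ (compile-correct R t)
compile-correct R first       = refl
compile-correct {L = L} {G} {γ} {δ} R (edge u v) =
  eval-at (atᵗ (var (matrix∈ L)) (compile L u)) (compile L v) δ {f = adj G (⟪ u ⟫ G γ)}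
    (eval-at (var (matrix∈ L)) (compile L u) δ {f = λ i → tabulate (adj G i)} (matrix≡ R) (compile-correct R u)) (compile-correct R v)
compile-correct {L = L} {δ = δ} R (equal u v) =
  eval-equal (compile L u) (compile L v) δ (compile-correct R u) (compile-correct R v)
compile-correct {L = L} {G} {γ} {δ} R (half X Y) =
  eval-half (compile L X) (compile L Y) δ {⟪ X ⟫ G γ} {⟪ Y ⟫ G γ} (compile-correct R X) (compile-correct R Y)
compile-correct {m = m} {L = L} {G} {γ} {δ} R (tab {τ} e) rewrite codes≡ R =
  trans (go (allFin (suc m))) (map-tabulate (λ v → v) _)
  where
  go : ∀ vs → foldr (λ x a → eval (compile (bind (skip L)) e) (x ∷ a ∷ δ) ∷ a) [] (map code vs)
              ≡ map (λ v → enc {τ = τ} (⟪ e ⟫ G (v ∷ γ))) vs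
  go []       = refl
  go (v ∷ vs) = cong₂ _∷_ (compile-correct (bind≡ (skip≡ R) refl) e) (go vs)
compile-correct {L = L} {G} {γ} {δ} R (index {τ} a v) =
  eval-at (compile L a) (compile L v) δ {f = λ i → enc {τ = τ} (⟪ a ⟫ G γ i)} (compile-correct R a) (compile-correct R v)
compile-correct {L = L} {G} {γ} {δ} R (times {τ} v z s)
  rewrite compile-correct R v | compile-correct R z = go (toℕ (⟪ v ⟫ G γ))
  where
  go : ∀ k → foldr (λ x a → eval (compile (skip (bind L)) s) (x ∷ a ∷ δ)) (enc {τ = τ} (⟪ z ⟫ G γ)) (replicate k true)
             ≡ enc {τ = τ} (repeat k (λ a → ⟪ s ⟫ G (a ∷ γ)) (⟪ z ⟫ G γ))
  go zero    = refl
  go (suc k) = compile-correct (skip≡ (bind≡ R (go k))) s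
compile-correct {m = m} {L = L} {G} {γ} {δ} R (loop {τ} z s)
  rewrite codes≡ R | compile-correct R z = go (allFin (suc m))
  where
  go : ∀ vs → foldr (λ x a → eval (compile (bind (bind L)) s) (x ∷ a ∷ δ)) (enc {τ = τ} (⟪ z ⟫ G γ)) (map code vs)
              ≡ enc {τ = τ} (foldr (λ v a → ⟪ s ⟫ G (v ∷ a ∷ γ)) (⟪ z ⟫ G γ) vs)
  go []       = refl
  go (v ∷ vs) = compile-correct (bind≡ (bind≡ R (go vs)) refl) s

-- Polynomial bounds on the cost of compiled code.

infixl 6 _⊕_
infixl 7 _⊛_

-- A syntax of polynomials: cost bounds follow the structure of an expression, and `poly-bound`
-- extracts a monomial bound at the end.
data Poly : Set where
  con     : ℕ → Poly
  N       : Poly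
  _⊕_ _⊛_ : Poly → Poly → Poly

_at_ : Poly → ℕ → ℕ
con c   at n = c
N       at n = n
(p ⊕ q) at n = p at n + q at n
(p ⊛ q) at n = p at n * q at n

poly-bound : ∀ p → ∃[ a ] ∃[ b ] (∀ n .{{_ : NonZero n}} → p at n ≤ a * n ^ b)
poly-bound (con c) = c , 0 , λ n → ≤-reflexive (sym (*-identityʳ c))
poly-bound N       = 1 , 1 , λ n → ≤-reflexive (sym (trans (+-identityʳ (n * 1)) (*-identityʳ n)))
poly-bound (p ⊕ q) with poly-bound p | poly-bound q
-- As n ≥ 1, both powers lie below `n ^ (b + b′)`, so exponents may be added here just as for a
-- product.
... | a , b , p≤ | a′ , b′ , q≤ = a + a′ , b + b′ , λ n → begin
  p at n + q at n                            ≤⟨ +-mono-≤ (p≤ n) (q≤ n) ⟩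
  a * n ^ b + a′ * n ^ b′                    ≤⟨ +-mono-≤ (*-monoʳ-≤ a (^-monoʳ-≤ n (m≤m+n b b′)))
                                                          (*-monoʳ-≤ a′ (^-monoʳ-≤ n (m≤n+m b′ b))) ⟩
  a * n ^ (b + b′) + a′ * n ^ (b + b′)       ≡⟨ *-distribʳ-+ (n ^ (b + b′)) a a′ ⟨
  (a + a′) * n ^ (b + b′)                    ∎
  where open ≤-Reasoning
poly-bound (p ⊛ q) with poly-bound p | poly-bound q
... | a , b , p≤ | a′ , b′ , q≤ = a * a′ , b + b′ , λ n → begin
  p at n * q at n               ≤⟨ *-mono-≤ (p≤ n) (q≤ n) ⟩
  a * n ^ b * (a′ * n ^ b′)     ≡⟨ [m*n]*[o*p]≡[m*o]*[n*p] a (n ^ b) a′ (n ^ b′) ⟩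
  a * a′ * (n ^ b * n ^ b′)     ≡⟨ cong (a * a′ *_) (^-distribˡ-+-* n b b′) ⟨
  a * a′ * n ^ (b + b′)         ∎
  where open ≤-Reasoning

-- The 4 per iteration is one unit for the fold and 3 for `tail₁`.
dropᵖ atᵖ : Poly → Poly → Poly
dropᵖ k xs = con 1 ⊕ k ⊕ xs ⊕ N ⊛ con 4
atᵖ xs k   = con 1 ⊕ dropᵖ k xs ⊕ con 1

bound : Exp Γ τ → Poly
bound (var x)       = con 1
bound (call f e)    = con 1 ⊕ bound e ⊕ bound f
bound true          = con 1
bound false         = con 1
bound (if b s t)    = con 1 ⊕ bound b ⊕ (bound s ⊕ bound t)
bound (pair s t)    = con 1 ⊕ bound s ⊕ bound t
bound (fst t)       = con 1 ⊕ bound t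
bound (snd t)       = con 1 ⊕ bound t
bound first         = con 1
bound (edge u v)    = atᵖ (atᵖ (con 1) (bound u)) (bound v)
bound (equal u v)   =
  con 1 ⊕ dropᵖ (bound u) (bound v) ⊕ (con 1 ⊕ dropᵖ (bound v) (bound u) ⊕ con 1)
bound (half A B)    =
  -- The factors 6 and 8 are one unit per iteration plus the worst costs 5 and 7 of the bodies in
  -- `truesᵗ` and `halfᵗ`; the 2 pays for `cons` and `true`.
  con 1 ⊕ (con 1 ⊕ bound A ⊕ (con 2 ⊕ (con 1 ⊕ bound B ⊕ con 1 ⊕ N ⊛ con 6)) ⊕ N ⊛ con 8) ⊕ con 1
bound (tab e)       = con 3 ⊕ N ⊛ (con 1 ⊕ (con 1 ⊕ bound e ⊕ con 1))
bound (index a v)   = atᵖ (bound a) (bound v)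
bound (times v z s) = con 1 ⊕ bound v ⊕ bound z ⊕ N ⊛ (con 1 ⊕ bound s)
bound (loop z s)    = con 2 ⊕ bound z ⊕ N ⊛ (con 1 ⊕ bound s)

module _ {σ τ : Ty} (s : Tm (σ ∷ τ ∷ Δ) τ) (δ : Env Δ)
         (Q : ⟦ σ ⟧ → Set) (P : ⟦ τ ⟧ → Set) (B : ℕ)
         (step : ∀ {x a} → Q x → P a → P (eval s (x ∷ a ∷ δ)) × cost s (x ∷ a ∷ δ) ≤ B) where

  -- The cost of a step may depend on the accumulator, so an invariant `P` of the accumulator is
  -- established together with the bound.
  foldCost-≤ : ∀ {z} → P z → ∀ {xs} → All Q xs →
               P (foldr (λ x a → eval s (x ∷ a ∷ δ)) z xs) × foldCost s δ z xs ≤ length xs * suc B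
  foldCost-≤ pz []       = pz , z≤n
  foldCost-≤ pz (q ∷ qs) with foldCost-≤ pz qs
  ... | p , c = proj₁ (step q p) ,
                s≤s (≤-trans (+-mono-≤ c (proj₂ (step q p))) (≤-reflexive (+-comm _ B)))

fold-cost-≤ : ∀ {σ τ} (l : Tm Δ (list σ)) (z : Tm Δ τ) (s : Tm (σ ∷ τ ∷ Δ) τ) (δ : Env Δ)
              (Q : ⟦ σ ⟧ → Set) (P : ⟦ τ ⟧ → Set) {p q r : ℕ} →
              (∀ {x a} → Q x → P a → P (eval s (x ∷ a ∷ δ)) × cost s (x ∷ a ∷ δ) ≤ r) →
              All Q (eval l δ) → length (eval l δ) ≤ n → P (eval z δ) →
              cost l δ ≤ p → cost z δ ≤ q →
              cost (fold l z s) δ ≤ 1 + p + q + n * suc r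
fold-cost-≤ l z s δ Q P {r = r} step qs len pz cl cz =
  +-mono-≤ (+-mono-≤ (s≤s cl) cz)
    (≤-trans (proj₂ (foldCost-≤ s δ Q P r step pz qs)) (*-monoˡ-≤ (suc r) len))

case-cost-≤ : ∀ {σ τ} (l : Tm Δ (list σ)) {z : Tm Δ τ} {s : Tm (σ ∷ list σ ∷ Δ) τ} (δ : Env Δ) {p q : ℕ} →
              cost l δ ≤ p → cost z δ ≤ q → (∀ x xs → cost s (x ∷ xs ∷ δ) ≤ q) →
              cost (case l z s) δ ≤ 1 + p + q
case-cost-≤ l δ cl cz cs with eval l δ
... | []     = +-mono-≤ (s≤s cl) cz
... | x ∷ xs = +-mono-≤ (s≤s cl) (cs x xs)

anything : ∀ {A : Set} (xs : List A) → All (λ _ → ⊤) xs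
anything = universal (λ _ → tt)

length-code : (i : Fin n) → length (code i) ≤ n
length-code i = ≤-trans (≤-reflexive (length-replicate (toℕ i))) (<⇒≤ (toℕ<n i))

drop-cost-≤ : ∀ {ν} (k : Tm Δ (list bool)) (xs : Tm Δ (list ν)) (δ : Env Δ) {i : Fin n} {p q : Poly} →
              eval k δ ≡ code i → cost k δ ≤ p at n → cost xs δ ≤ q at n →
              cost (dropᵗ k xs) δ ≤ dropᵖ p q at n
drop-cost-≤ k xs δ {i} e ck cxs =
  fold-cost-≤ k xs tail₁ δ (λ _ → ⊤) (λ _ → ⊤)
    (λ {x} {a} _ _ → tt , case-cost-≤ (var #1) (x ∷ a ∷ δ) ≤-refl ≤-refl (λ _ _ → ≤-refl))
    (anything _) (subst (λ l → length l ≤ _) (sym e) (length-code i)) tt ck cxs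

at-cost-≤ : ∀ {ν} (xs : Tm Δ (list ν)) (k : Tm Δ (list bool)) (δ : Env Δ)
            {f : Fin n → ⟦ ν ⟧} {i : Fin n} {p q : Poly} →
            eval xs δ ≡ tabulate f → eval k δ ≡ code i → cost xs δ ≤ p at n → cost k δ ≤ q at n →
            cost (atᵗ xs k) δ ≤ atᵖ p q at n
at-cost-≤ xs k δ {f} {i} {p} {q} ef ei cxs ck
  with drop-cost-≤ k xs δ {i} {q} {p} ei ck cxs
... | c rewrite trans (eval-drop k xs δ {i} ei) (trans (cong (drop (toℕ i)) ef) (drop-tabulate f i))
  = +-monoˡ-≤ 1 (s≤s c)

equal-cost-≤ : (u v : Tm Δ (list bool)) (δ : Env Δ) {i j : Fin n} {p q : Poly} →
               eval u δ ≡ code i → eval v δ ≡ code j → cost u δ ≤ p at n → cost v δ ≤ q at n →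
               cost (equalᵗ u v) δ ≤ (con 1 ⊕ dropᵖ p q ⊕ (con 1 ⊕ dropᵖ q p ⊕ con 1)) at n
equal-cost-≤ u v δ {i} {j} {p} {q} eu ev cu cv =
  case-cost-≤ (dropᵗ u v) δ (drop-cost-≤ u v δ {i} {p} {q} eu cu cv)
    (case-cost-≤ (dropᵗ v u) δ (drop-cost-≤ v u δ {j} {q} {p} ev cv cu) ≤-refl (λ _ _ → ≤-refl))
    (λ _ _ → s≤s z≤n)

half-cost-≤ : (X Y : Tm Δ (list bool)) (δ : Env Δ) {f g : Fin n → Bool} {p q : Poly} →
              eval X δ ≡ tabulate f → eval Y δ ≡ tabulate g → cost X δ ≤ p at n → cost Y δ ≤ q at n →
              cost (halfᵗ X Y) δ ≤
              (con 1 ⊕ (con 1 ⊕ p ⊕ (con 2 ⊕ (con 1 ⊕ q ⊕ con 1 ⊕ N ⊛ con 6)) ⊕ N ⊛ con 8) ⊕ con 1) at n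
half-cost-≤ {Δ} {n} X Y δ {f} {g} eX eY cX cY =
  case-cost-≤ (fold X (cons true (truesᵗ Y)) remove₂) δ
    (fold-cost-≤ X (cons true (truesᵗ Y)) remove₂ δ (λ _ → ⊤) (λ _ → ⊤)
      (λ {x} {a} _ _ → tt , remove₂-cost x a) (anything _) (len eX) tt cX
      (s≤s (s≤s (fold-cost-≤ Y nil _ δ (λ _ → ⊤) (λ _ → ⊤)
        (λ {x} {a} _ _ → tt , cons-cost x a) (anything _) (len eY) tt cY ≤-refl))))
    ≤-refl (λ _ _ → ≤-refl)
  where
  len : ∀ {f : Fin n → Bool} {xs} → xs ≡ tabulate f → length xs ≤ n
  len {f} refl = ≤-reflexive (length-tabulate f)

  remove₂-cost : ∀ x a → cost remove₂ (x ∷ a ∷ δ) ≤ 7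
  remove₂-cost true  []          = ≤-refl
  remove₂-cost true  (_ ∷ [])    = ≤-refl
  remove₂-cost true  (_ ∷ _ ∷ _) = ≤-refl
  remove₂-cost false a           = s≤s (s≤s (s≤s z≤n))

  cons-cost : ∀ x (a : List Bool) → cost (if (var #0) (cons true (var #1)) (var #1)) (x ∷ a ∷ δ) ≤ 5
  cons-cost true  a = ≤-refl
  cons-cost false a = s≤s (s≤s (s≤s z≤n))

length-codes : ∀ n → length (codes n) ≡ n
length-codes n = trans (length-map code (allFin n)) (length-tabulate (λ i → i))

IsCode : ℕ → List Bool → Set
IsCode n xs = ∃[ i ] xs ≡ code {n} i

-- The accumulator invariant for compiled folds: the cost bound of a compiled body is available only
-- where the environment encodes values.
Encodes : ∀ m τ → ⟦ tr τ ⟧ → Set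
Encodes m τ x = ∃[ v ] x ≡ enc {m} {τ} v

all-codes : ∀ n → All (IsCode n) (codes n)
all-codes n = map⁺ (universal (λ i → i , refl) (allFin n))

compile-cost : {L : Layout Γ Δ} {G : Graph (suc m)} {γ : Vals m Γ} {δ : Env Δ} →
               Represents L G γ δ → (e : Exp Γ τ) → cost (compile L e) δ ≤ bound e at suc m
compile-cost R (var x)    = ≤-refl
compile-cost R (call f e) =
  +-mono-≤ (s≤s (compile-cost R e)) (compile-cost (bind≡ (forget≡ R) (compile-correct R e)) f)
compile-cost R true       = ≤-refl
compile-cost R false      = ≤-refl
compile-cost {L = L} {G} {γ} R (if b s t) rewrite compile-correct R b with ⟪ b ⟫ G γ
... | true  = +-mono-≤ (s≤s (compile-cost R b)) (≤-trans (compile-cost R s) (m≤m+n _ _))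
... | false = +-mono-≤ (s≤s (compile-cost R b)) (≤-trans (compile-cost R t) (m≤n+m _ _))
compile-cost R (pair s t) = +-mono-≤ (s≤s (compile-cost R s)) (compile-cost R t)
compile-cost R (fst t)    = s≤s (compile-cost R t)
compile-cost R (snd t)    = s≤s (compile-cost R t)
compile-cost R first      = ≤-refl
compile-cost {L = L} {G} {γ} {δ} R (edge u v) =
  at-cost-≤ (atᵗ (var (matrix∈ L)) (compile L u)) (compile L v) δ
    {f = adj G (⟪ u ⟫ G γ)} {p = atᵖ (con 1) (bound u)} {bound v}
    (eval-at (var (matrix∈ L)) (compile L u) δ {f = λ i → tabulate (adj G i)} (matrix≡ R) (compile-correct R u))
    (compile-correct R v)
    (at-cost-≤ (var (matrix∈ L)) (compile L u) δ {f = λ i → tabulate (adj G i)} {p = con 1} {bound u}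
      (matrix≡ R) (compile-correct R u) ≤-refl (compile-cost R u))
    (compile-cost R v)
compile-cost {L = L} {G} {γ} {δ} R (equal u v) =
  equal-cost-≤ (compile L u) (compile L v) δ {p = bound u} {bound v}
    (compile-correct R u) (compile-correct R v) (compile-cost R u) (compile-cost R v)
compile-cost {L = L} {G} {γ} {δ} R (half A B) =
  half-cost-≤ (compile L A) (compile L B) δ {⟪ A ⟫ G γ} {⟪ B ⟫ G γ} {bound A} {bound B}
    (compile-correct R A) (compile-correct R B) (compile-cost R A) (compile-cost R B)
compile-cost {m = m} {L = L} {G} {γ} {δ} R (tab e) =
  fold-cost-≤ (var (codes∈ L)) nil (cons (compile (bind (skip L)) e) (var #1)) δ (IsCode (suc m)) (λ _ → ⊤)
    (λ { (i , refl) _ → tt , +-monoˡ-≤ 1 (s≤s (compile-cost (bind≡ (skip≡ R) refl) e)) })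
    (subst (All _) (sym (codes≡ R)) (all-codes (suc m)))
    (≤-reflexive (trans (cong length (codes≡ R)) (length-codes (suc m)))) tt ≤-refl ≤-refl
compile-cost {L = L} {G} {γ} {δ} R (index {τ} a v) =
  at-cost-≤ (compile L a) (compile L v) δ {f = λ i → enc {τ = τ} (⟪ a ⟫ G γ i)} {p = bound a} {bound v}
    (compile-correct R a) (compile-correct R v) (compile-cost R a) (compile-cost R v)
compile-cost {m = m} {L = L} {G} {γ} {δ} R (times {τ} v z s) =
  fold-cost-≤ (compile L v) (compile L z) (compile (skip (bind L)) s) δ (λ _ → ⊤) (Encodes m τ)
    (λ { _ (a , refl) → (⟪ s ⟫ G (a ∷ γ) , compile-correct (skip≡ (bind≡ R refl)) s)
                      , compile-cost (skip≡ (bind≡ R refl)) s })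
    (anything _) (subst (λ l → length l ≤ suc m) (sym (compile-correct R v)) (length-code (⟪ v ⟫ G γ)))
    (⟪ z ⟫ G γ , compile-correct R z) (compile-cost R v) (compile-cost R z)
compile-cost {m = m} {L = L} {G} {γ} {δ} R (loop {τ} z s) =
  fold-cost-≤ (var (codes∈ L)) (compile L z) (compile (bind (bind L)) s) δ (IsCode (suc m)) (Encodes m τ)
    (λ { (i , refl) (a , refl) → (⟪ s ⟫ G (i ∷ a ∷ γ) , compile-correct (bind≡ (bind≡ R refl) refl) s)
                               , compile-cost (bind≡ (bind≡ R refl) refl) s })
    (subst (All _) (sym (codes≡ R)) (all-codes (suc m)))
    (≤-reflexive (trans (cong length (codes≡ R)) (length-codes (suc m))))
    (⟪ z ⟫ G γ , compile-correct R z) ≤-refl (compile-cost R z)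

-- Complete programs and their running time.

prependᵗ : Tm (list bool ∷ list (list bool) ∷ list (list bool) ∷ []) (list (list bool))
prependᵗ = cons nil (fold (var #1) nil (cons (cons true (var #0)) (var #1)))

-- The rows of the input matrix serve as a counter: each one raises the codes built so far by one
-- and puts the code of vertex zero in front.
codesᵗ : Tm (list (list bool) ∷ []) (list (list bool))
codesᵗ = fold (var #0) nil prependᵗ

layout : Layout [] (list (list bool) ∷ list (list bool) ∷ [])
layout .matrix∈ = #1
layout .codes∈  = #0
layout .place ()

program : Exp [] (arr (arr bool)) → Program
program e = let′ codesᵗ (compile layout e)

programBound : Exp [] (arr (arr bool)) → Poly
programBound e = con 1 ⊕ (con 3 ⊕ N ⊛ (con 6 ⊕ N ⊛ con 6)) ⊕ bound e

eval-prepend : ∀ x (a M : List (List Bool)) → eval prependᵗ (x ∷ a ∷ M ∷ []) ≡ [] ∷ map (true ∷_) a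
eval-prepend x a M = cong ([] ∷_) (go a)
  where
  go : ∀ xs → foldr (λ y b → (true ∷ y) ∷ b) [] xs ≡ map (true ∷_) xs
  go []       = refl
  go (x ∷ xs) = cong (_ ∷_) (go xs)

codes-suc : ∀ n → [] ∷ map (true ∷_) (codes n) ≡ codes (suc n)
codes-suc n = cong ([] ∷_) (trans (sym (map-∘ (allFin n)))
  (trans (map-tabulate (λ i → i) (λ i → true ∷ code i)) (sym (map-tabulate suc code))))

eval-prepends : ∀ (xs M : List (List Bool)) →
                foldr (λ x a → eval prependᵗ (x ∷ a ∷ M ∷ [])) [] xs ≡ codes (length xs)
eval-prepends []       M = refl
eval-prepends (x ∷ xs) M =
  trans (cong (λ a → eval prependᵗ (x ∷ a ∷ M ∷ [])) (eval-prepends xs M))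
    (trans (eval-prepend x (codes (length xs)) M) (codes-suc (length xs)))

prepend-cost-≤ : ∀ x (a M : List (List Bool)) → length a ≤ n → cost prependᵗ (x ∷ a ∷ M ∷ []) ≤ 5 + n * 6
prepend-cost-≤ x a M len = s≤s (s≤s (fold-cost-≤ (var #1) nil _ (x ∷ a ∷ M ∷ []) (λ _ → ⊤) (λ _ → ⊤)
  (λ _ _ → tt , ≤-refl) (anything _) len tt ≤-refl ≤-refl))

prepends-cost-≤ : ∀ (xs M : List (List Bool)) → length xs ≤ n →
                  foldCost prependᵗ (M ∷ []) [] xs ≤ length xs * (6 + n * 6)
prepends-cost-≤ []       M len = z≤n
prepends-cost-≤ {n} (x ∷ xs) M len = s≤s (≤-trans
  (+-mono-≤ (prepends-cost-≤ xs M (<⇒≤ len)) (prepend-cost-≤ x (foldr (λ y a → eval prependᵗ (y ∷ a ∷ M ∷ [])) [] xs) M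
    (≤-trans (≤-reflexive (trans (cong length (eval-prepends xs M)) (length-codes (length xs)))) (<⇒≤ len))))
  (≤-reflexive (+-comm _ (5 + n * 6))))

layout≡ : (G : Graph (suc m)) → Represents layout G [] (codes (suc m) ∷ matrix G ∷ [])
layout≡ G .matrix≡ = refl
layout≡ G .codes≡  = refl
layout≡ G .place≡ ()

module _ (G : Graph (suc m)) where

  length-matrix : length (matrix G) ≡ suc m
  length-matrix = length-tabulate (λ u → tabulate (adj G u))

  eval-codes : eval codesᵗ (matrix G ∷ []) ≡ codes (suc m)
  eval-codes = trans (eval-prepends (matrix G) (matrix G)) (cong codes length-matrix)

  output-program : (e : Exp [] (arr (arr bool))) →
                   output (program e) G ≡ tabulate (λ u → tabulate (λ v → ⟪ e ⟫ G [] u v))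
  output-program e = trans (cong (λ c → eval (compile layout e) (c ∷ matrix G ∷ [])) eval-codes)
                           (compile-correct (layout≡ G) e)

  time-program : (e : Exp [] (arr (arr bool))) →
                 time (program e) G ≤ programBound e at suc m
  time-program e = +-mono-≤
    (s≤s (s≤s (s≤s (s≤s (≤-trans (prepends-cost-≤ {suc m} (matrix G) (matrix G) (≤-reflexive length-matrix))
                        (*-monoˡ-≤ (6 + suc m * 6) (≤-reflexive length-matrix)))))))
    (≤-trans (≤-reflexive (cong (λ c → cost (compile layout e) (c ∷ matrix G ∷ [])) eval-codes))
             (compile-cost (layout≡ G) e))

  -- Compiled code sees only the encodings of its inputs, so it cannot tell
  -- pointwise equal arrays apart.
  extensional : (f : Exp (σ ∷ []) τ) {x y : Val m σ} → enc {τ = σ} x ≡ enc {τ = σ} y →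
                enc {τ = τ} (⟪ f ⟫ G (x ∷ [])) ≡ enc {τ = τ} (⟪ f ⟫ G (y ∷ []))
  extensional f e = trans (sym (compile-correct (bind≡ (layout≡ G) refl) f))
                          (compile-correct (bind≡ (layout≡ G) e) f)

code-injective : {i j : Fin n} → code i ≡ code j → i ≡ j
code-injective {i = i} {j} e = toℕ-injective (trans (sym (length-replicate (toℕ i)))
  (trans (cong length e) (length-replicate (toℕ j))))

-- Walks

Inside : Graph n → (Fin n → Set) → Fin n → Fin n → ℕ → Set
Inside G P u v ℓ = Σ[ p ∈ Walk G u v ℓ ] All P (vertices p)

adj-symmetric : (G : Graph n) → ∀ {u v} → Adj G u v → Adj G v u
adj-symmetric G {u} {v} e = trans (adj-sym G v u) e

adj-distinct : (G : Graph n) → ∀ {u v} → Adj G u v → u ≢ v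
adj-distinct G {u} e refl with trans (sym e) (adj-irrefl G u)
... | ()

module _ {G : Graph n} where

  anywhere : ∀ {u v ℓ} → Walk G u v ℓ → Inside G (λ _ → ⊤) u v ℓ
  anywhere p = p , universal (λ _ → tt) (vertices p)

  private variable
    P Q : Fin n → Set
    u v w : Fin n
    ℓ ℓ′ : ℕ

  weaken : (∀ {x} → P x → Q x) → Inside G P u v ℓ → Inside G Q u v ℓ
  weaken f (p , ps) = p , All.map f ps

  stay : P u → Inside G P u u 0
  stay pu = [] , pu ∷ []

  step : P u → Adj G u v → Inside G P v w ℓ → Inside G P u w (suc ℓ)
  step pu e (p , ps) = e ∷ p , pu ∷ ps

  source : Inside G P u v ℓ → P u
  source ([] , pu ∷ _)    = pu
  source (_ ∷ _ , pu ∷ _) = pu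

  target : Inside G P u v ℓ → P v
  target ([] , pu ∷ _)    = pu
  target (_ ∷ p , _ ∷ ps) = target (p , ps)

  join : Inside G P u v ℓ → Inside G P v w ℓ′ → Inside G P u w (ℓ + ℓ′)
  join ([] , _)           q = q
  join (e ∷ p , pu ∷ ps) q = step pu e (join (p , ps) q)

  back : Inside G P u v ℓ → Inside G P v u ℓ
  back {P = P} {u} {v} p = subst (Inside G P v u) (+-identityʳ _) (go p (stay (source p)))
    where
    go : ∀ {x y ℓ₁ ℓ₂} → Inside G P x y ℓ₁ → Inside G P x u ℓ₂ → Inside G P y u (ℓ₁ + ℓ₂)
    go ([] , _) q = q
    go {ℓ₁ = suc ℓ₁} {ℓ₂} (e ∷ p , _ ∷ ps) q =
      subst (Inside G P _ u) (+-suc ℓ₁ ℓ₂)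
        (go (p , ps) (step (source (p , ps)) (adj-symmetric G e) q))

  Simple : (Fin n → Set) → Fin n → Fin n → ℕ → Set
  Simple P u v ℓ = Σ[ p ∈ Walk G u v ℓ ] (Unique (vertices p) × All P (vertices p))

  suffix : ∀ {x} ((p , _) : Simple P u v ℓ) → x ∈ˡ vertices p → ∃[ ℓ′ ] (ℓ′ ≤ ℓ × Simple P x v ℓ′)
  suffix s@([] , _) (here refl)    = _ , ≤-refl , s
  suffix s@(_ ∷ _ , _) (here refl) = _ , ≤-refl , s
  suffix (_ ∷ p , _ ∷ uq , _ ∷ ps) (there x∈) with suffix (p , uq , ps) x∈
  ... | ℓ′ , ≤ℓ , s = ℓ′ , m≤n⇒m≤1+n ≤ℓ , s

  simplify : Inside G P u v ℓ → ∃[ ℓ′ ] (ℓ′ ≤ ℓ × Simple P u v ℓ′)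
  simplify ([] , ps) = _ , ≤-refl , [] , [] ∷ [] , ps
  simplify {u = u} (e ∷ p , pu ∷ ps) with simplify (p , ps)
  ... | ℓ′ , ≤ℓ , s@(q , uq , qs) with Any.any? (u F.≟_) (vertices q)
  -- If `u` recurs on the simple walk, the detour up to that occurrence is dropped.
  ...   | yes u∈ = let ℓ″ , ≤ℓ′ , s′ = suffix s u∈ in ℓ″ , m≤n⇒m≤1+n (≤-trans ≤ℓ′ ≤ℓ) , s′
  ...   | no  u∉ = suc ℓ′ , s≤s ≤ℓ , e ∷ q , ¬Any⇒All¬ _ u∉ ∷ uq , pu ∷ qs

  length-vertices : (p : Walk G u v ℓ) → length (vertices p) ≡ suc ℓ
  length-vertices []      = refl
  length-vertices (_ ∷ p) = cong suc (length-vertices p)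

-- The pigeonhole principle, by deleting the head of `xs` from `ys` and recursing.
unique-length-≤ : ∀ {A : Set} {xs ys : List A} → Unique xs → (∀ {x} → x ∈ˡ xs → x ∈ˡ ys) →
                  length xs ≤ length ys
unique-length-≤ []        sub = z≤n
unique-length-≤ {xs = x ∷ xs} (x∉ ∷ uq) sub with ∈-∃++ (sub (here refl))
... | as , bs , refl = ≤-trans (s≤s (unique-length-≤ uq sub′)) (≤-reflexive (sym (begin
  length (as ++ x ∷ bs)       ≡⟨ length-++ as ⟩
  length as + suc (length bs) ≡⟨ +-suc (length as) (length bs) ⟩
  suc (length as + length bs) ≡⟨ cong suc (length-++ as) ⟨
  suc (length (as ++ bs))     ∎)))
  where
  open ≡-Reasoning
  sub′ : ∀ {y} → y ∈ˡ xs → y ∈ˡ as ++ bs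
  sub′ y∈ with ∈-++⁻ as (sub (there y∈))
  ... | inj₁ y∈as         = ∈-++⁺ˡ y∈as
  ... | inj₂ (here refl)  = ⊥-elim (All.lookup x∉ y∈ refl)
  ... | inj₂ (there y∈bs) = ∈-++⁺ʳ as y∈bs

module _ {G : Graph n} where

  simple-length : ∀ {P u v ℓ} → Simple {G = G} P u v ℓ → ℓ < n
  simple-length {ℓ = ℓ} (p , uq , _) = begin
    suc ℓ                  ≡⟨ length-vertices p ⟨
    length (vertices p)    ≤⟨ unique-length-≤ uq (λ _ → ∈-allFin _) ⟩
    length (allFin n)      ≡⟨ length-tabulate id ⟩
    n                      ∎
    where open ≤-Reasoning

  -- The bound ℓ′ < n is what lets vertices name all walk lengths that the algorithm has to try.
  shorten : ∀ {P u v ℓ} → Inside G P u v ℓ → ∃[ ℓ′ ] (ℓ′ ≤ ℓ × ℓ′ < n × Inside G P u v ℓ′)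
  shorten p with simplify p
  ... | ℓ′ , ≤ℓ , s@(q , _ , qs) = ℓ′ , ≤ℓ , simple-length s , q , qs

  walk? : ∀ ℓ u v → Dec (Walk G u v ℓ)
  walk? zero u v with u F.≟ v
  ... | yes refl = yes []
  ... | no  u≢v  = no λ { [] → u≢v refl }
  walk? (suc ℓ) u v with any? (λ w → (adj G u w Bool.≟ true) ×-dec walk? ℓ w v)
  ... | yes (w , e , p) = yes (e ∷ p)
  ... | no  none        = no λ { (e ∷ p) → none (_ , e , p) }

  -- Having a walk of a given length is decidable, so searching upwards from 0 finds the least
  -- length.
  distance : ∀ {u v ℓ} → Walk G u v ℓ → ∃[ d ] (Dist G u v d × d ≤ ℓ)
  distance {u} {v} p = go _ p
    where
    below : ∀ k → (∃[ d ] (Dist G u v d × d < k)) ⊎ (∀ ℓ → ℓ < k → ¬ Walk G u v ℓ)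
    below zero    = inj₂ λ _ ()
    below (suc k) with below k
    ... | inj₁ (d , m , d<k) = inj₁ (d , m , m≤n⇒m≤1+n d<k)
    ... | inj₂ none with walk? k u v
    ...   | yes p = inj₁ (k , (p , λ r q → ≮⇒≥ (λ r<k → none r r<k q)) , ≤-refl)
    ...   | no ¬p = inj₂ λ ℓ ℓ<1+k q → case-≤ ℓ (m≤n⇒m<n∨m≡n (s≤s⁻¹ ℓ<1+k)) q
      where
      case-≤ : ∀ ℓ → ℓ < k ⊎ ℓ ≡ k → ¬ Walk G u v ℓ
      case-≤ ℓ (inj₁ ℓ<k)  q = none ℓ ℓ<k q
      case-≤ ℓ (inj₂ refl) q = ¬p q

    go : ∀ ℓ → Walk G u v ℓ → ∃[ d ] (Dist G u v d × d ≤ ℓ)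
    go ℓ p with below (suc ℓ)
    ... | inj₁ (d , m , d<1+ℓ) = d , m , s≤s⁻¹ d<1+ℓ
    ... | inj₂ none            = ⊥-elim (none ℓ ≤-refl p)

-- Balanced bags of tree-decompositions

module _ {G : Graph n} where

  prefix : ∀ {P u v x ℓ} ((p , _) : Simple {G = G} P u v ℓ) → x ∈ˡ vertices p →
           ∃[ ℓ′ ] Simple {G = G} P u x ℓ′
  prefix ([] , _ , ps) (here refl)          = _ , [] , [] ∷ [] , ps
  prefix (_ ∷ _ , _ , pu ∷ _) (here refl)   = _ , [] , [] ∷ [] , pu ∷ []
  prefix (e ∷ p , u∉ ∷ uq , pu ∷ ps) (there x∈) with prefix (p , uq , All.zip (u∉ , ps)) x∈
  ... | _ , q , uq′ , both = _ , e ∷ q , proj₁ (All.unzip both) ∷ uq′ , pu ∷ proj₂ (All.unzip both)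

  nontrivial : ∀ {u v ℓ} → Walk G u v ℓ → u ≢ v → 1 ≤ ℓ
  nontrivial []      u≢u = ⊥-elim (u≢u refl)
  nontrivial (_ ∷ _) _   = s≤s z≤n

  module _ (acyclic : ¬ Cycle G) where

    -- An edge of a tree is a bridge: going from j to g and back to the second node of the walk from
    -- i to g, always off i, closes a cycle through i. That second node differs from j, so the cycle
    -- has at least three nodes.
    no-bypass : ∀ {i j g ℓ ℓ′} → Adj G i j →
                Inside G (_≢ i) j g ℓ → Inside G (_≢ j) i g ℓ′ → ⊥
    no-bypass {i} {j} ij jg ig with simplify ig
    ... | _ , _ , [] , _ = target jg refl
    ... | _ , _ , iy ∷ q , i∉ ∷ _ , _ ∷ avoid-j
      with simplify (join jg (back (q , All.map ≢-sym i∉)))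
    ...   | _ , _ , [] , _ = source (q , avoid-j) refl
    ...   | _ , _ , p@(_ ∷ _) , uq , avoid-i =
      acyclic (_ , _ , _ , ij ∷ p , All.map ≢-sym avoid-i ∷ uq , s≤s (s≤s z≤n) , adj-symmetric G iy)

    -- Following the pointers without ever turning back would extend a simple
    -- walk forever or close a cycle.
    pointers-meet : (next : Fin n → Fin n) → (∀ i → Adj G i (next i)) → Fin n →
                    ∃[ i ] next (next i) ≡ i
    pointers-meet next next-adj i₀ =
      go n (m≤n+m n 1) (adj-symmetric G (next-adj i₀)) refl
        ([] , [] ∷ [] , ≢-sym (adj-distinct G (next-adj i₀)) ∷ [])
      where
      -- The simple walk leads from `prev` backwards through the nodes visited before; `cur` is the
      -- newest node.
      go : ∀ {cur prev v ℓ} fuel → n ≤ suc ℓ + fuel → Adj G cur prev → next prev ≡ cur →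
           Simple {G = G} (cur ≢_) prev v ℓ → ∃[ i ] next (next i) ≡ i
      go {cur} {prev} fuel enough e refl s@(q , uq , cur∉) with next cur F.≟ prev
      ... | yes back-again = prev , back-again
      ... | no  onward with Any.any? (next cur F.≟_) (vertices q)
      ...   | yes w∈ with prefix s w∈
      ...     | _ , p , up , cur∉p =
        ⊥-elim (acyclic (_ , _ , _ , e ∷ p , cur∉p ∷ up , s≤s (nontrivial p (≢-sym onward))
                        , adj-symmetric G (next-adj cur)))
      -- Without fuel the simple walk `e ∷ q` would have more than n vertices.
      go {cur} {ℓ = ℓ} zero enough e refl (q , uq , cur∉) | no onward | no w∉ =
        ⊥-elim (<⇒≱ (simple-length {G = G} {P = λ _ → ⊤} (e ∷ q , cur∉ ∷ uq , universal (λ _ → tt) _))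
                    (subst (n ≤_) (+-identityʳ (suc ℓ)) enough))
      go {cur} {ℓ = ℓ} (suc fuel) enough e refl (q , uq , cur∉) | no onward | no w∉ =
        go fuel (subst (n ≤_) (+-suc (suc ℓ) fuel) enough) (adj-symmetric G (next-adj cur)) refl
          (e ∷ q , cur∉ ∷ uq , ≢-sym (adj-distinct G (next-adj cur)) ∷ ¬Any⇒All¬ _ w∉)

-- Sizes of vertex sets.

_∋_ : (Fin n → Bool) → Fin n → Set
A ∋ v = A v ≡ true

count-disjoint : (A B C : Fin n → Bool) → (∀ u → A ∋ u → C ∋ u) → (∀ u → B ∋ u → C ∋ u) →
                 (∀ u → A ∋ u → ¬ B ∋ u) → count A + count B ≤ count C
count-disjoint {zero}  A B C A⊆C B⊆C A∩B = z≤n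
count-disjoint {suc n} A B C A⊆C B⊆C A∩B
  with A zero in a | B zero in b | C zero in c
     | count-disjoint (A ∘ suc) (B ∘ suc) (C ∘ suc) (λ u → A⊆C (suc u)) (λ u → B⊆C (suc u)) (λ u → A∩B (suc u))
... | false | false | false | ih = ih
... | false | false | true  | ih = m≤n⇒m≤1+n ih
... | true  | false | true  | ih = s≤s ih
... | false | true  | true  | ih = ≤-trans (≤-reflexive (+-suc _ _)) (s≤s ih)
... | true  | true  | _     | ih = ⊥-elim (A∩B zero a b)
... | true  | false | false | ih with () ← trans (sym c) (A⊆C zero a)
... | false | true  | false | ih with () ← trans (sym c) (B⊆C zero b)

count-mono : (A C : Fin n → Bool) → (∀ u → A ∋ u → C ∋ u) → count A ≤ count C
count-mono A C A⊆C = ≤-trans (m≤m+n (count A) _)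
  (count-disjoint A (λ _ → false) C A⊆C (λ _ ()) (λ _ _ ()))

count-positive : (A : Fin n → Bool) {u : Fin n} → A ∋ u → 1 ≤ count A
count-positive A {zero}  e rewrite e = s≤s z≤n
count-positive A {suc u} e = ≤-trans (count-positive (A ∘ suc) e) (m≤n+m _ _)

count-≤ : (A : Fin n → Bool) → count A ≤ n
count-≤ {zero}  A = z≤n
count-≤ {suc n} A with A zero
... | true  = s≤s (count-≤ (A ∘ suc))
... | false = m≤n⇒m≤1+n (count-≤ (A ∘ suc))

-- Existence of a balanced bag.

module _ {G : Graph n} (D : TreeDecomposition G) (C : Fin n → Bool) where

  Off : Fin (size D) → Fin n → Set
  Off i u = C ∋ u × u ∉ˢ bag D i

  -- `K i v` will be the component of v in C minus the bag of i, as the algorithm computes it.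
  module _ (K : Fin (size D) → Fin n → Fin n → Bool)
           (K-sound : ∀ i v u → K i v ∋ u → ∃[ ℓ ] Inside G (Off i) u v ℓ) where

    Light : Fin (size D) → Fin n → Set
    Light i v = 2 * count (K i v) ≤ count C

    AllLight : Fin (size D) → Set
    AllLight i = ∀ v → Off i v → Light i v

    light? : ∀ i v → Dec (Off i v → Light i v)
    light? i v with C v Bool.≟ true | v ∈ˢ? bag D i | 2 * count (K i v) ≤? count C
    ... | no ¬c | _       | _     = yes λ (c , _) → ⊥-elim (¬c c)
    ... | yes c | yes v∈  | _     = yes λ (_ , v∉) → ⊥-elim (v∉ v∈)
    ... | yes c | no v∉   | yes l = yes λ _ → l
    ... | yes c | no v∉   | no ¬l = no λ f → ¬l (f (c , v∉))

    -- A heavy component at i lies behind one neighbour of i in the tree.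
    record Pointer (i : Fin (size D)) : Set where
      field
        next   : Fin (size D)
        root   : Fin n
        heavy       : count C < 2 * count (K i root)
        next-adj    : Adj (tree D) i next
        behind      : ∀ {u g} → K i root ∋ u → u ∈ˢ bag D g → ∃[ ℓ ] Inside (tree D) (_≢ i) next g ℓ

    private
      -- A walk in G off bag i is shadowed by a tree walk off node i: consecutive vertices share a
      -- bag, the bags of one vertex are connected, and none of them is bag i.
      follow : ∀ {i j f g v u ℓ ℓ′} → Inside (tree D) (_≢ i) j f ℓ′ → v ∈ˢ bag D f → Inside G (Off i) v u ℓ →
               u ∈ˢ bag D g → ∃[ ℓ ] Inside (tree D) (_≢ i) j g ℓ
      follow {i} {f = f} {g} {v} jf v∈f ([] , (_ , v∉i) ∷ []) v∈g with subtree D v f g v∈f v∈g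
      ... | _ , p , ps = _ , join jf (p , All.map (λ { v∈x refl → v∉i v∈x }) ps)
      follow {i} {f = f} {g} {v} jf v∈f (e ∷ w , (_ , v∉i) ∷ ws) u∈g with edge-bag D v _ e
      ... | h , v∈h , v′∈h with subtree D v f h v∈f v∈h
      ...   | _ , p , ps =
        follow (join jf (p , All.map (λ { v∈x refl → v∉i v∈x }) ps)) v′∈h (w , ws) u∈g

      -- A simple tree walk from i to a bag of the heavy root leaves i for good with its first edge,
      -- and that edge is the pointer.
      pointer : ∀ i → ¬ AllLight i → Pointer i
      pointer i ¬light with ¬∀⟶∃¬ n (λ v → Off i v → Light i v) (light? i) ¬light
      ... | v , ¬l with covers D v | C v Bool.≟ true | v ∈ˢ? bag D i | 2 * count (K i v) ≤? count C
      ...   | _ | no ¬c | _      | _     = ⊥-elim (¬l λ (c , _) → ⊥-elim (¬c c))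
      ...   | _ | yes c | yes v∈ | _     = ⊥-elim (¬l λ (_ , v∉) → ⊥-elim (v∉ v∈))
      ...   | _ | yes c | no v∉  | yes l = ⊥-elim (¬l λ _ → l)
      ...   | f , v∈f | yes c | no v∉ | no ¬light′ with proj₁ (isTree D) i f tt tt
      ...     | _ , p with simplify p
      ...       | _ , _ , [] , _ = ⊥-elim (v∉ v∈f)
      ...       | _ , _ , e ∷ q , i∉ ∷ _ , _ = record
        { next = _ ; root = v ; heavy = ≰⇒> ¬light′ ; next-adj = e
        ; behind = λ {u} u∈K u∈g →
            follow (q , All.map ≢-sym i∉) v∈f (back (proj₂ (K-sound i v u u∈K))) u∈g }

      -- A common vertex of the two heavy components would have a bag behind both ends of the tree
      -- edge, against `no-bypass`; disjoint heavy components would together exceed C.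
      opposed : ∀ {i} (p : Pointer i) (q : Pointer (Pointer.next p)) → Pointer.next q ≢ i
      opposed {i} p q turn with any? (λ u → (A u Bool.≟ true) ×-dec (B u Bool.≟ true))
        where
        A = K i (Pointer.root p)
        B = K (Pointer.next p) (Pointer.root q)
      ... | yes (u , a , b) =
        let g , u∈g = covers D u
            _ , jg  = Pointer.behind p a u∈g
            _ , ig  = Pointer.behind q b u∈g
        in no-bypass (proj₂ (isTree D)) (Pointer.next-adj p) jg
             (subst (λ x → Inside (tree D) (_≢ Pointer.next p) x g _) turn ig)
      ... | no disjoint = <⇒≱ (+-mono-< (Pointer.heavy p) (Pointer.heavy q)) (begin
        2 * count A + 2 * count B ≡⟨ *-distribˡ-+ 2 (count A) (count B) ⟨
        2 * (count A + count B)   ≤⟨ *-monoʳ-≤ 2 (count-disjoint A B C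
                                       (λ u a → proj₁ (source (proj₂ (K-sound _ _ u a))))
                                       (λ u b → proj₁ (source (proj₂ (K-sound _ _ u b))))
                                       (λ u a b → disjoint (u , a , b))) ⟩
        2 * count C               ≡⟨ cong (count C +_) (+-identityʳ (count C)) ⟩
        count C + count C         ∎)
        where
        open ≤-Reasoning
        A = K i (Pointer.root p)
        B = K (Pointer.next p) (Pointer.root q)

    balanced-bag : Fin n → ∃[ i ] AllLight i
    balanced-bag v₀ with any? (λ i → all? (light? i))
    ... | yes found = found
    ... | no  none  =
      let ptr i     = pointer i (λ l → none (i , l))
          i , turn  = pointers-meet (proj₂ (isTree D)) (λ i → Pointer.next (ptr i))
                        (λ i → Pointer.next-adj (ptr i)) (proj₁ (covers D v₀))
      in ⊥-elim (opposed (ptr i) (ptr (Pointer.next (ptr i))) turn)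

-- The algorithm

infixr 6 _∧ᵉ_
infixr 5 _∨ᵉ_

_∧ᵉ_ _∨ᵉ_ : Exp Γ bool → Exp Γ bool → Exp Γ bool
b ∧ᵉ c = if b c false
b ∨ᵉ c = if b true c

notᵉ : Exp Γ bool → Exp Γ bool
notᵉ b = if b false true

-- Tabulating `e` first avoids weakening it past the accumulator of the loop.
existsᵉ : Exp (vert ∷ Γ) bool → Exp Γ bool
existsᵉ e = call (loop false (index (var #2) (var #0) ∨ᵉ var #1)) (tab e)

-- There is no unit type, so a dummy boolean ends each tuple. For separators the first entry of
-- `Tuple (suc k)` is the common radius and the other k are the centres.
Tuple : ℕ → Type
Tuple zero    = bool
Tuple (suc k) = vert ⊗ Tuple k

reachᵉ : Exp (arr bool ⊗ vert ⊗ vert ∷ []) (arr bool)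
reachᵉ = times (snd (snd (var #0)))
  (tab (index (fst (var #1)) (var #0) ∧ᵉ equal (var #0) (fst (snd (var #1)))))
  (tab (index (fst (var #2)) (var #0) ∧ᵉ
        (index (var #1) (var #0) ∨ᵉ existsᵉ (edge (var #1) (var #0) ∧ᵉ index (var #2) (var #0)))))

-- The number of steps ranges over the vertices, that is, over 0 to n - 1, which covers all simple
-- walks.
componentᵉ : Exp (arr bool ⊗ vert ∷ []) (arr bool)
componentᵉ = tab (existsᵉ
  (index (call reachᵉ (pair (fst (var #2)) (pair (snd (var #2)) (var #0)))) (var #1)))

ballᵉ : Exp (vert ⊗ vert ∷ []) (arr bool)
ballᵉ = call reachᵉ (pair (tab true) (var #0))

inDisksᵉ : ∀ k → Exp (vert ⊗ Tuple (suc k) ∷ []) bool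
inDisksᵉ zero    = false
inDisksᵉ (suc k) =
  index (call ballᵉ (pair (fst (snd (snd (var #0)))) (fst (snd (var #0))))) (fst (var #0))
  ∨ᵉ call (inDisksᵉ k) (pair (fst (var #0)) (pair (fst (snd (var #0))) (snd (snd (snd (var #0))))))

restᵉ : ∀ k → Exp (arr bool ⊗ Tuple (suc k) ∷ []) (arr bool)
restᵉ k = tab (index (fst (var #1)) (var #0) ∧ᵉ notᵉ (call (inDisksᵉ k) (pair (var #0) (snd (var #1)))))

lightᵉ : Exp (arr bool ⊗ arr bool ∷ []) bool
lightᵉ = notᵉ (existsᵉ (index (snd (var #1)) (var #0) ∧ᵉ
  notᵉ (half (call componentᵉ (pair (snd (var #1)) (var #0))) (fst (var #1)))))

balancedᵉ : ∀ k → Exp (arr bool ⊗ Tuple (suc k) ∷ []) bool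
balancedᵉ k = call lightᵉ (pair (fst (var #0)) (call (restᵉ k) (var #0)))

firstsᵉ : ∀ k → Exp Γ (Tuple k)
firstsᵉ zero    = true
firstsᵉ (suc k) = pair first (firstsᵉ k)

fixᵉ : ∀ {k} → Exp (σ ⊗ Tuple (suc k) ∷ []) bool → Exp ((σ ⊗ vert) ⊗ Tuple k ∷ []) bool
fixᵉ p = call p (pair (fst (fst (var #0))) (pair (snd (fst (var #0))) (snd (var #0))))

-- The first k-tuple (in lexicographic order) with the given property, and a
-- junk value if there is none.
findᵉ : ∀ k → Exp (σ ⊗ Tuple k ∷ []) bool → Exp (σ ∷ []) (Tuple k)
findᵉ zero        p = call p (pair (var #0) true)
findᵉ {σ} (suc k) p = loop (firstsᵉ (suc k)) (if (call p (pair (var #2) t)) t (var #1))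
  where
  t : Exp (vert ∷ Tuple (suc k) ∷ σ ∷ []) (Tuple (suc k))
  t = pair (var #0) (call (findᵉ k (fixᵉ p)) (pair (var #2) (var #0)))

-- The radius leads the tuple, so the first balanced tuple has least radius, and the program can run
-- without knowing ρ.
separatorᵉ : ∀ k → Exp (arr bool ∷ []) (Tuple (suc k))
separatorᵉ k = findᵉ (suc k) (balancedᵉ k)

-- On the argument ((u, c), (r, w, _)), w is a neighbour of u at distance at most r from c. Since r
-- is searched first, `parentᵉ` returns a neighbour nearest to c.
closerᵉ : Exp ((vert ⊗ vert) ⊗ Tuple 2 ∷ []) bool
closerᵉ = edge (fst (fst (var #0))) (fst (snd (snd (var #0)))) ∧ᵉ
  index (call ballᵉ (pair (snd (fst (var #0))) (fst (snd (var #0))))) (fst (snd (snd (var #0))))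

parentᵉ : Exp (vert ⊗ vert ∷ []) vert
parentᵉ = fst (snd (findᵉ 2 closerᵉ))

isParentᵉ : ∀ k → Exp (vert ⊗ vert ⊗ Tuple k ∷ []) bool
isParentᵉ zero    = false
isParentᵉ (suc k) =
  equal (call parentᵉ (pair (fst (var #0)) (fst (snd (snd (var #0)))))) (fst (snd (var #0)))
  ∨ᵉ call (isParentᵉ k) (pair (fst (var #0)) (pair (fst (snd (var #0))) (snd (snd (snd (var #0))))))

separatorOfᵉ : ∀ k → Exp (arr bool ⊗ vert ∷ []) (Tuple (suc k))
separatorOfᵉ k = call (separatorᵉ k) (call componentᵉ (var #0))

-- The active vertices and the edges chosen so far, directed from a vertex to its parents.
State : Type
State = arr bool ⊗ arr (arr bool)

roundᵉ : ∀ k → Exp (State ∷ []) State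
roundᵉ k = pair
  (tab (index (fst (var #1)) (var #0) ∧ᵉ
        notᵉ (call (inDisksᵉ k) (pair (var #0) (call (separatorOfᵉ k) (pair (fst (var #1)) (var #0)))))))
  (tab (tab (index (index (snd (var #2)) (var #1)) (var #0) ∨ᵉ
             index (fst (var #2)) (var #1) ∧ᵉ
             call (isParentᵉ k) (pair (var #1) (pair (var #0)
               (snd (call (separatorOfᵉ k) (pair (fst (var #2)) (var #1)))))))))

spannerᵉ : ∀ k → Exp [] (arr (arr bool))
spannerᵉ k = call
  -- The edge test keeps the result inside G even where a search returned junk; the disjunction
  -- forgets directions.
  (tab (tab (edge (var #1) (var #0) ∧ᵉ
    (index (index (snd (var #2)) (var #1)) (var #0) ∨ᵉ index (index (snd (var #2)) (var #0)) (var #1)))))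
  -- Running n rounds is enough because ⌊log₂ n⌋ < n; a round without active vertices changes
  -- nothing.
  (loop (pair (tab true) (tab (tab false))) (call (roundᵉ k) (var #1)))

-- Correctness of the parts of the algorithm.

module _ {a b : Bool} where

  ∧-intro : a ≡ true → b ≡ true → (if a then b else false) ≡ true
  ∧-intro refl refl = refl

  ∨-introˡ : a ≡ true → (if a then true else b) ≡ true
  ∨-introˡ refl = refl

∧-elim : ∀ {a b : Bool} → (if a then b else false) ≡ true → a ≡ true × b ≡ true
∧-elim {true}  e = refl , e
∧-elim {false} ()

∨-introʳ : ∀ (a : Bool) {b : Bool} → b ≡ true → (if a then true else b) ≡ true
∨-introʳ true  _ = refl
∨-introʳ false e = e

∨-elim : ∀ (a : Bool) {b : Bool} → (if a then true else b) ≡ true → a ≡ true ⊎ b ≡ true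
∨-elim true  _ = inj₁ refl
∨-elim false e = inj₂ e

negation : Bool → Bool
negation a = if a then false else true

not-intro : ∀ {a : Bool} → ¬ (a ≡ true) → negation a ≡ true
not-intro {true}  f = ⊥-elim (f refl)
not-intro {false} _ = refl

not-elim : ∀ {a : Bool} → negation a ≡ true → ¬ (a ≡ true)
not-elim {true}  ()
not-elim {false} _ ()

⌊⌋-elim : ∀ {A : Set} (d : Dec A) → ⌊ d ⌋ ≡ true → A
⌊⌋-elim (yes a) _ = a

⌊⌋-intro : ∀ {A : Set} (d : Dec A) → A → ⌊ d ⌋ ≡ true
⌊⌋-intro (yes _) _ = refl
⌊⌋-intro (no ¬a) a = ⊥-elim (¬a a)

any : List (Fin n) → (Fin n → Bool) → Bool
any vs f = foldr (λ v b → if f v then true else b) false vs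

any-elim : ∀ vs {f : Fin n → Bool} → any vs f ≡ true → ∃[ v ] f v ≡ true
any-elim (v ∷ vs) {f} e with f v in fv
... | true  = v , fv
... | false = any-elim vs e

any-intro : ∀ {vs} {f : Fin n → Bool} {v} → v ∈ˡ vs → f v ≡ true → any vs f ≡ true
any-intro (here refl) e                   = ∨-introˡ e
any-intro {f = f} (there {x = w} v∈) e = ∨-introʳ (f w) (any-intro v∈ e)

toList : ∀ k → Val m (Tuple k) → List (Fin (suc m))
toList zero    _        = []
toList (suc k) (c , cs) = c ∷ toList k cs

length-toList : ∀ k (cs : Val m (Tuple k)) → length (toList k cs) ≡ k
length-toList zero    _        = refl
length-toList (suc k) (c , cs) = cong suc (length-toList k cs)

tuple : ∀ k → (Fin k → Fin (suc m)) → Val m (Tuple k)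
tuple zero    c = true
tuple (suc k) c = c zero , tuple k (c ∘ suc)

∈-tuple : ∀ k (c : Fin k → Fin (suc m)) j → c j ∈ˡ toList k (tuple k c)
∈-tuple (suc k) c zero    = here refl
∈-tuple (suc k) c (suc j) = there (∈-tuple k (c ∘ suc) j)

enc-tuple-injective : ∀ k {x y : Val m (Tuple k)} → enc {τ = Tuple k} x ≡ enc {τ = Tuple k} y → x ≡ y
enc-tuple-injective zero    e = e
enc-tuple-injective (suc k) e =
  cong₂ _,_ (code-injective (cong proj₁ e)) (enc-tuple-injective k (cong proj₂ e))

-- In a right fold an earlier hit overrides all later ones. The list has the form `tabulate h` so
-- that the induction can pass to `h ∘ suc`.
first-hit : ∀ {A B : Set} {q : A → Bool} {g : A → B} {z} n (h : Fin n → A) i → q (h i) ≡ true →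
            ∃[ j ] (toℕ j ≤ toℕ i × q (h j) ≡ true
                   × foldr (λ v b → if q v then g v else b) z (tabulate h) ≡ g (h j))
first-hit {q = q} {g} (suc n) h i e with q (h zero) in e₀
... | true = zero , z≤n , e₀ , refl
first-hit {q = q} {g} (suc n) h zero e | false with () ← trans (sym e) e₀
first-hit {q = q} {g} (suc n) h (suc i) e | false with first-hit {q = q} {g} n (h ∘ suc) i e
... | j , j≤i , qj , eq = suc j , s≤s j≤i , qj , eq

module _ {m : ℕ} (G : Graph (suc m)) where

  find : ∀ k (p : Exp (σ ⊗ Tuple k ∷ []) bool) → Val m σ → Val m (Tuple k)
  find k p s = ⟪ findᵉ k p ⟫ G (s ∷ [])

  find-correct : ∀ k (p : Exp (σ ⊗ Tuple k ∷ []) bool) s t → ⟪ p ⟫ G ((s , t) ∷ []) ≡ true →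
                 ⟪ p ⟫ G ((s , find k p s) ∷ []) ≡ true
  find-least : ∀ k (p : Exp (σ ⊗ Tuple (suc k) ∷ []) bool) s v t → ⟪ p ⟫ G ((s , (v , t)) ∷ []) ≡ true →
               ∃[ j ] ∃[ t′ ] (toℕ j ≤ toℕ v × ⟪ p ⟫ G ((s , (j , t′)) ∷ []) ≡ true × find (suc k) p s ≡ (j , t′))

  -- At length zero the search returns the value of `p` at the dummy `true`. If this value is
  -- `false`, the given solution `t` must be `false` too, which is what the search returned.
  find-correct zero    p s t e with ⟪ p ⟫ G ((s , true) ∷ []) in p-true
  ... | true  = p-true
  ... | false with t
  ...   | true with () ← trans (sym e) p-true
  ...   | false = e
  find-correct (suc k) p s (v , t) e with find-least k p s v t e
  ... | j , t′ , _ , e′ , eq = trans (cong (λ x → ⟪ p ⟫ G ((s , x) ∷ [])) eq) e′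

  find-least k p s v t e
    with first-hit {q = λ v → ⟪ p ⟫ G ((s , (v , find k (fixᵉ p) (s , v))) ∷ [])}
                   {g = λ v → v , find k (fixᵉ p) (s , v)} _ id v
                   (find-correct k (fixᵉ p) (s , v) t e)
  ... | j , j≤v , pj , eq = j , _ , j≤v , pj , eq

  vertices∈ : {v : Fin (suc m)} → v ∈ˡ allFin (suc m)
  vertices∈ {v = v} = ∈-allFin v

  -- What `reachᵉ` denotes, with a plain number of steps to allow induction on it.
  reach : (Fin (suc m) → Bool) → Fin (suc m) → ℕ → Fin (suc m) → Bool
  reach X v j = repeat j
    (λ Y u → if X u then (if Y u then true else any (allFin (suc m)) (λ w → if adj G u w then Y w else false)) else false)
    (λ u → if X u then ⌊ u F.≟ v ⌋ else false)

  reach-sound : ∀ X v j u → reach X v j ∋ u → ∃[ ℓ ] (ℓ ≤ j × Inside G (X ∋_) u v ℓ)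
  reach-sound X v zero u e with ∧-elim {X u} e
  ... | Xu , eq with refl ← ⌊⌋-elim (u F.≟ v) eq = 0 , z≤n , stay Xu
  reach-sound X v (suc j) u e with ∧-elim {X u} e
  ... | Xu , e′ with ∨-elim (reach X v j u) e′
  ...   | inj₁ Yu = let ℓ , ≤j , p = reach-sound X v j u Yu in ℓ , m≤n⇒m≤1+n ≤j , p
  ...   | inj₂ e″ with any-elim (allFin (suc m)) e″
  ...     | w , e‴ with ∧-elim {adj G u w} e‴
  ...       | uw , Yw = let ℓ , ≤j , p = reach-sound X v j w Yw in suc ℓ , s≤s ≤j , step Xu uw p

  reach-complete : ∀ X v j {u ℓ} → ℓ ≤ j → Inside G (X ∋_) u v ℓ → reach X v j ∋ u
  reach-complete X v zero {u} _ ([] , Xu ∷ _) = ∧-intro Xu (⌊⌋-intro (u F.≟ u) refl)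
  reach-complete X v (suc j) {u} _ ([] , Xu ∷ _) =
    ∧-intro Xu (∨-introˡ (reach-complete X v j z≤n (stay Xu)))
  reach-complete X v (suc j) {u} (s≤s ≤j) (e ∷ p , Xu ∷ ps) =
    ∧-intro Xu (∨-introʳ (reach X v j u)
      (any-intro vertices∈ (∧-intro e (reach-complete X v j ≤j (p , ps)))))

  opaque

    component : (Fin (suc m) → Bool) → Fin (suc m) → Fin (suc m) → Bool
    component X v = ⟪ componentᵉ ⟫ G ((X , v) ∷ [])

    component-sound : ∀ X v u → component X v ∋ u → ∃[ ℓ ] Inside G (X ∋_) u v ℓ
    component-sound X v u e with any-elim (allFin (suc m)) e
    ... | r , e′ with reach-sound X v (toℕ r) u e′
    ...   | ℓ , _ , p = ℓ , p

    component-complete : ∀ X v {u ℓ} → Inside G (X ∋_) u v ℓ → component X v ∋ u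
    component-complete X v {u} p with shorten p
    ... | ℓ , _ , ℓ<n , q = any-intro {v = fromℕ< ℓ<n} vertices∈
      (reach-complete X v _ (≤-reflexive (sym (toℕ-fromℕ< ℓ<n))) q)

    component-cong : ∀ X {u v ℓ} → Inside G (X ∋_) u v ℓ → ∀ x → component X u x ≡ component X v x
    component-cong X {u} {v} p x = same (λ e → grow p e) (λ e → grow (back p) e)
      where
      same : ∀ {a b : Bool} → (a ≡ true → b ≡ true) → (b ≡ true → a ≡ true) → a ≡ b
      same {true}  {true}  f g = refl
      same {true}  {false} f g = sym (f refl)
      same {false} {true}  f g = g refl
      same {false} {false} f g = refl

      grow : ∀ {u v ℓ} → Inside G (X ∋_) u v ℓ → component X u ∋ x → component X v ∋ x
      grow {u} {v} p e = component-complete X v (join (proj₂ (component-sound X u x e)) p)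

    ball : Fin (suc m) → Fin (suc m) → Fin (suc m) → Bool
    ball c r = ⟪ ballᵉ ⟫ G ((c , r) ∷ [])

    ball-sound : ∀ c r u → ball c r ∋ u → ∃[ ℓ ] (ℓ ≤ toℕ r × Walk G u c ℓ)
    ball-sound c r u e with reach-sound (λ _ → true) c (toℕ r) u e
    ... | ℓ , ≤r , p , _ = ℓ , ≤r , p

    -- A radius is a vertex and hence at most `m`. Longer walks can be shortened to that length, so
    -- capping at `m` loses nothing.
    ball-complete : ∀ c r {u ℓ} → Walk G u c ℓ → ℓ ⊓ m ≤ toℕ r → ball c r ∋ u
    ball-complete c r p ≤r with shorten (anywhere p)
    ... | ℓ′ , ≤ℓ , ℓ′<n , q , _ = reach-complete (λ _ → true) c (toℕ r)
      (≤-trans (⊓-glb ≤ℓ (s≤s⁻¹ ℓ′<n)) ≤r) (q , universal (λ _ → refl) _)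

    cap : ℕ → Fin (suc m)
    cap ℓ = fromℕ< (s≤s (m⊓n≤n ℓ m))

    toℕ-cap : ∀ ℓ → toℕ (cap ℓ) ≡ ℓ ⊓ m
    toℕ-cap ℓ = toℕ-fromℕ< (s≤s (m⊓n≤n ℓ m))

    cap-≤ : ∀ ℓ → toℕ (cap ℓ) ≤ ℓ
    cap-≤ ℓ = ≤-trans (≤-reflexive (toℕ-cap ℓ)) (m⊓n≤m ℓ m)

    ball-cap : ∀ c t {u ℓ} → Walk G u c ℓ → ℓ ≤ t → ball c (cap t) ∋ u
    ball-cap c t {ℓ = ℓ} p ≤t =
      ball-complete c (cap t) p (≤-trans (⊓-monoˡ-≤ m ≤t) (≤-reflexive (sym (toℕ-cap t))))

  InDisks : ∀ k → Val m (Tuple (suc k)) → Fin (suc m) → Set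
  InDisks k (r , cs) u = ∃[ c ] (c ∈ˡ toList k cs × ball c r ∋ u)

  opaque
    unfolding ball

    inDisks : ∀ k → Fin (suc m) → Val m (Tuple (suc k)) → Bool
    inDisks k u s = ⟪ inDisksᵉ k ⟫ G ((u , s) ∷ [])

    inDisks-sound : ∀ k u s → inDisks k u s ≡ true → InDisks k s u
    inDisks-sound (suc k) u (r , c , cs) e with ∨-elim (ball c r u) e
    ... | inj₁ u∈ = c , here refl , u∈
    ... | inj₂ e′ with inDisks-sound k u (r , cs) e′
    ...   | c′ , c′∈ , u∈ = c′ , there c′∈ , u∈

    inDisks-complete : ∀ k u s → InDisks k s u → inDisks k u s ≡ true
    inDisks-complete (suc k) u (r , c , cs) (_ , here refl , u∈) = ∨-introˡ u∈
    inDisks-complete (suc k) u (r , c , cs) (c′ , there c′∈ , u∈) =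
      ∨-introʳ (ball c r u) (inDisks-complete k u (r , cs) (c′ , c′∈ , u∈))

    rest : ∀ k → (Fin (suc m) → Bool) → Val m (Tuple (suc k)) → Fin (suc m) → Bool
    rest k C s = ⟪ restᵉ k ⟫ G ((C , s) ∷ [])

    rest-sound : ∀ k C s u → rest k C s ∋ u → C ∋ u × ¬ InDisks k s u
    rest-sound k C s u e with ∧-elim {C u} e
    ... | Cu , e′ = Cu , λ d → not-elim {inDisks k u s} e′ (inDisks-complete k u s d)

    rest-complete : ∀ k C s {u} → C ∋ u → ¬ InDisks k s u → rest k C s ∋ u
    rest-complete k C s {u} Cu ¬d = ∧-intro Cu (not-intro (λ e → ¬d (inDisks-sound k u s e)))

  Balanced : ∀ k → (Fin (suc m) → Bool) → Val m (Tuple (suc k)) → Set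
  Balanced k C s = ∀ v → rest k C s ∋ v → 2 * count (component (rest k C s) v) ≤ count C

  opaque
    unfolding component ball inDisks rest

    balanced : ∀ k → (Fin (suc m) → Bool) → Val m (Tuple (suc k)) → Bool
    balanced k C s = ⟪ balancedᵉ k ⟫ G ((C , s) ∷ [])

    balanced-sound : ∀ k C s → balanced k C s ≡ true → Balanced k C s
    balanced-sound k C s e v v∈ with 2 * count (component (rest k C s) v) ≤? count C
    ... | yes ok = ok
    ... | no bad = ⊥-elim (not-elim e (any-intro {v = v} vertices∈
      (∧-intro v∈ (not-intro (λ h → bad (≤ᵇ⇒≤ _ _ (Equivalence.from T-≡ h)))))))

    balanced-complete : ∀ k C s → Balanced k C s → balanced k C s ≡ true
    balanced-complete k C s ok = not-intro λ e → let v , e′ = any-elim (allFin (suc m)) e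
                                                     v∈ , e″ = ∧-elim {rest k C s v} e′
      in not-elim e″ (Equivalence.to T-≡ (≤⇒≤ᵇ (ok v v∈)))

    separator : ∀ k → (Fin (suc m) → Bool) → Val m (Tuple (suc k))
    separator k C = ⟪ separatorᵉ k ⟫ G (C ∷ [])

    -- Pointwise equal sets have the same encoding, and a tuple is determined by its encoding, so no
    -- function extensionality enters.
    separator-cong : ∀ k {C C′} → (∀ u → C u ≡ C′ u) → separator k C ≡ separator k C′
    separator-cong k {C} {C′} eq =
      enc-tuple-injective (suc k) {separator k C} {separator k C′}
        (extensional G (separatorᵉ k) {C} {C′} (tabulate-cong eq))

    separator-spec : ∀ k C s → Balanced k C s →
                     Balanced k C (separator k C) × toℕ (proj₁ (separator k C)) ≤ toℕ (proj₁ s)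
    separator-spec k C (r , cs) b =
      let j , cs′ , j≤r , e , eq = find-least k (balancedᵉ k) C r cs (balanced-complete k C (r , cs) b)
      in subst (Balanced k C) (sym eq) (balanced-sound k C (j , cs′) e) ,
         ≤-trans (≤-reflexive (cong (λ s → toℕ (proj₁ s)) eq)) j≤r

    -- The disks cover a balanced bag, so each component that they leave lies in a component left by
    -- the bag.
    balanced-exists : ∀ k (D : TreeDecomposition G) {t} → CoveredByDisks k D t → ∀ C →
                      ∃[ s ] (Balanced k C s × toℕ (proj₁ s) ≤ t)
    balanced-exists k D {t} covered C with balanced-bag D C (λ i v → component (off i) v) K-sound zero
      where
      off : Fin (size D) → Fin (suc m) → Bool
      off i u = if C u then negation ⌊ u ∈ˢ? bag D i ⌋ else false
      K-sound : ∀ i v u → component (off i) v ∋ u → ∃[ ℓ ] Inside G (Off D C i) u v ℓ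
      K-sound i v u e with component-sound (off i) v u e
      ... | ℓ , p = ℓ , weaken (λ {x} e → let Cx , e′ = ∧-elim {C x} e
                                          in Cx , λ x∈ → not-elim e′ (⌊⌋-intro (x ∈ˢ? bag D i) x∈)) p
    ... | i , light with covered i
    ...   | c , inside = (cap t , tuple k c) , ok , cap-≤ t
      where
      s : Val m (Tuple (suc k))
      s = cap t , tuple k c
      off : Fin (suc m) → Bool
      off u = if C u then negation ⌊ u ∈ˢ? bag D i ⌋ else false
      rest⊆off : ∀ {u} → rest k C s ∋ u → C ∋ u × u ∉ˢ bag D i
      rest⊆off {u} e with rest-sound k C s u e
      ... | Cu , ¬d = Cu , λ u∈ → let j , d , ((p , _) , d≤t) = inside u u∈
                                  in ¬d (c j , ∈-tuple k c j , ball-cap (c j) t p d≤t)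
      ok : Balanced k C s
      ok v v∈ = ≤-trans (*-monoʳ-≤ 2 (count-mono (component (rest k C s) v) (component off v)
        (λ u u∈ → component-complete off v (weaken
          (λ {x} e → ∧-intro (proj₁ (rest⊆off e)) (not-intro (λ x∈ → proj₂ (rest⊆off e) (⌊⌋-elim (x ∈ˢ? bag D i) x∈))))
          (proj₂ (component-sound (rest k C s) v u u∈))))))
        (light v (rest⊆off v∈))

    parent : Fin (suc m) → Fin (suc m) → Fin (suc m)
    parent u c = ⟪ parentᵉ ⟫ G ((u , c) ∷ [])

    -- The neighbour w with radius ℓ, capped, is a solution of the search, so the least radius found
    -- is at most ℓ.
    parent-spec : ∀ u c {w ℓ} → Adj G u w → Walk G w c ℓ →
                  Adj G u (parent u c) × ∃[ ℓ′ ] (ℓ′ ≤ ℓ × Walk G (parent u c) c ℓ′)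
    parent-spec u c {w} {ℓ} uw p
      with find-least 1 closerᵉ (u , c) (cap ℓ) (w , true) (∧-intro uw (ball-cap c ℓ p ≤-refl))
    ... | j , (y , _) , j≤r , e , eq with ∧-elim {adj G u y} e
    ...   | uy , y∈ with ball-sound c j y y∈
    ...     | ℓ′ , ≤j , q rewrite cong (λ s → proj₁ (proj₂ s)) eq =
      uy , ℓ′ , ≤-trans ≤j (≤-trans j≤r (cap-≤ ℓ)) , q

    isParent : ∀ k → Fin (suc m) → Fin (suc m) → Val m (Tuple k) → Bool
    isParent k u v cs = ⟪ isParentᵉ k ⟫ G ((u , v , cs) ∷ [])

    isParent-sound : ∀ k u v cs → isParent k u v cs ≡ true → v ∈ˡ map (parent u) (toList k cs)
    isParent-sound (suc k) u v (c , cs) e with ∨-elim ⌊ parent u c F.≟ v ⌋ e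
    ... | inj₁ e′ = here (sym (⌊⌋-elim (parent u c F.≟ v) e′))
    ... | inj₂ e′ = there (isParent-sound k u v cs e′)

    isParent-complete : ∀ k u cs {c} → c ∈ˡ toList k cs → isParent k u (parent u c) cs ≡ true
    isParent-complete (suc k) u (c , cs) (here refl) = ∨-introˡ (⌊⌋-intro (parent u c F.≟ parent u c) refl)
    isParent-complete (suc k) u (c , cs) {c′} (there c∈) =
      ∨-introʳ ⌊ parent u c F.≟ parent u c′ ⌋ (isParent-complete k u cs c∈)

  module _ (k : ℕ) where

    opaque
      unfolding separator component inDisks isParent

      round : Val m State → Val m State
      round S = ⟪ roundᵉ k ⟫ G (S ∷ [])

      round-active : ∀ S u → proj₁ (round S) u ≡
        (if proj₁ S u then negation (inDisks k u (separator k (component (proj₁ S) u))) else false)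
      round-active S u = refl

      round-edge : ∀ S u v → proj₂ (round S) u v ≡
        (if proj₂ S u v then true else
         if proj₁ S u then isParent k u v (proj₂ (separator k (component (proj₁ S) u))) else false)
      round-edge S u v = refl

    foldr-const : ∀ {A B : Set} (f : A → A) (z : A) (xs : List B) →
                  foldr (λ _ a → f a) z xs ≡ repeat (length xs) f z
    foldr-const f z []       = refl
    foldr-const f z (_ ∷ xs) = cong f (foldr-const f z xs)

    state : ℕ → Val m State
    state i = repeat i round ((λ _ → true) , λ _ _ → false)

    active : ℕ → Fin (suc m) → Bool
    active i = proj₁ (state i)

    chosen : ℕ → Fin (suc m) → Fin (suc m) → Bool
    chosen i = proj₂ (state i)

    opaque
      unfolding round

      spanner-correct : ∀ u v → ⟪ spannerᵉ k ⟫ G [] u v ≡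
        (if adj G u v then (if chosen (suc m) u v then true else chosen (suc m) v u) else false)
      spanner-correct u v =
        cong (λ S → if adj G u v then (if proj₂ S u v then true else proj₂ S v u) else false)
          (trans (foldr-const round ((λ _ → true) , λ _ _ → false) (allFin (suc m)))
                 (cong (λ j → repeat j round ((λ _ → true) , λ _ _ → false)) (length-tabulate {n = suc m} id)))

-- Stretch and size of the spanner

m<2^m : ∀ j → j < 2 ^ j
m<2^m zero    = s≤s z≤n
m<2^m (suc j) = ≤-trans (s≤s (m<2^m j)) (+-mono-≤ (m^n>0 2 j) (m≤m+n (2 ^ j) 0))

log-lower : ∀ {i n} → 2 ^ i ≤ n → i ≤ ⌊log₂ n ⌋
log-lower {i} 2^i≤n = ≤-trans (≤-reflexive (sym (⌊log₂[2^n]⌋≡n i))) (⌊log₂⌋-mono-≤ 2^i≤n)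

-- Strong induction by halving, with ⌊log₂ n⌋ = 1 + ⌊log₂ ⌊n/2⌋⌋ for n ≥ 2.
2^log-≤ : ∀ n → 1 ≤ n → 2 ^ ⌊log₂ n ⌋ ≤ n
2^log-≤ = <-rec _ go
  where
  open ≤-Reasoning
  go : ∀ n → (∀ {k} → k < n → 1 ≤ k → 2 ^ ⌊log₂ k ⌋ ≤ k) → 1 ≤ n → 2 ^ ⌊log₂ n ⌋ ≤ n
  go (suc zero)      rec _ = s≤s z≤n
  go n@(suc (suc l)) rec _ = begin
    2 ^ ⌊log₂ n ⌋                ≡⟨ cong (2 ^_) (m+[n∸m]≡n (⌊log₂⌋-mono-≤ {2} {n} (s≤s (s≤s z≤n)))) ⟨
    2 ^ suc (⌊log₂ n ⌋ ∸ 1)      ≡⟨ cong (λ j → 2 ^ suc j) (⌊log₂⌊n/2⌋⌋≡⌊log₂n⌋∸1 n) ⟨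
    2 * 2 ^ ⌊log₂ ⌊ n /2⌋ ⌋      ≤⟨ *-monoʳ-≤ 2 (rec (⌊n/2⌋<n (suc l)) (s≤s z≤n)) ⟩
    2 * ⌊ n /2⌋                  ≡⟨ cong (⌊ n /2⌋ +_) (+-identityʳ ⌊ n /2⌋) ⟩
    ⌊ n /2⌋ + ⌊ n /2⌋            ≤⟨ +-monoʳ-≤ ⌊ n /2⌋ (⌊n/2⌋≤⌈n/2⌉ n) ⟩
    ⌊ n /2⌋ + ⌈ n /2⌉            ≡⟨ ⌊n/2⌋+⌈n/2⌉≡n n ⟩
    n                            ∎

log<n : ∀ n → 1 ≤ n → ⌊log₂ n ⌋ < n
log<n n 1≤n = ≤-trans (m<2^m ⌊log₂ n ⌋) (2^log-≤ n 1≤n)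

-- Paying 2ρ in each of 1 + ⌊log₂ n⌋ rounds stays within the allowed error: rounding the logarithm
-- before multiplying only lowers the product.
log-error : ∀ ρ n → 1 ≤ n → suc ⌊log₂ n ⌋ * (2 * ρ) ≤ additiveError ρ n
log-error ρ n 1≤n = +-monoʳ-≤ (2 * ρ) (log-lower (begin
  2 ^ (⌊log₂ n ⌋ * (2 * ρ))   ≡⟨ ^-*-assoc 2 ⌊log₂ n ⌋ (2 * ρ) ⟨
  (2 ^ ⌊log₂ n ⌋) ^ (2 * ρ)   ≤⟨ ^-monoˡ-≤ (2 * ρ) (2^log-≤ n 1≤n) ⟩
  n ^ (2 * ρ)                 ∎))
  where open ≤-Reasoning

length-concatMap : ∀ {A B : Set} (f : A → List B) c → (∀ x → length (f x) ≡ c) →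
                   ∀ xs → length (concatMap f xs) ≡ length xs * c
length-concatMap f c eq []       = refl
length-concatMap f c eq (x ∷ xs) =
  trans (length-++ (f x)) (cong₂ _+_ (eq x) (length-concatMap f c eq xs))

_▹_ : ∀ {G : Graph n} {u v w a b} → Walk G u v a → Walk G v w b → Walk G u w (a + b)
p ▹ q = proj₁ (join (anywhere p) (anywhere q))

reverse : ∀ {G : Graph n} {u v a} → Walk G u v a → Walk G v u a
reverse p = proj₁ (back (anywhere p))

-- Each vertex keeps its remaining walk to v, which in `halving` shows that the whole walk lies in
-- one component.
trace : ∀ {G : Graph n} {P u v ℓ} → Inside G P u v ℓ →
        Inside G (λ x → P x × ∃[ ℓ′ ] Inside G P x v ℓ′) u v ℓ
trace ([] , pu ∷ []) = stay (pu , _ , stay pu)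
trace (e ∷ p , pu ∷ ps) = step (pu , _ , step pu e (p , ps)) e (trace (p , ps))

module _ {m : ℕ} (G : Graph (suc m)) (k : ℕ) where

  private
    n₁ = suc m

    U : ℕ → Fin n₁ → Bool
    U = active G k

    E : ℕ → Fin n₁ → Fin n₁ → Bool
    E = chosen G k

  sep : ℕ → Fin n₁ → Val m (Tuple (suc k))
  sep i u = separator G k (component G (U i) u)

  centres : ℕ → Fin n₁ → List (Fin n₁)
  centres i u = toList k (proj₂ (sep i u))

  active-sound : ∀ i u → U (suc i) ∋ u → U i ∋ u × ¬ InDisks G k (sep i u) u
  active-sound i u e with ∧-elim {U i u} (trans (sym (round-active G k (state G k i) u)) e)
  ... | Uu , e′ = Uu , λ d → not-elim e′ (inDisks-complete G k u (sep i u) d)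

  removed : ∀ i u → U i ∋ u → ¬ U (suc i) ∋ u → InDisks G k (sep i u) u
  removed i u Uu ¬U with inDisks G k u (sep i u) Bool.≟ true
  ... | yes d = inDisks-sound G k u (sep i u) d
  ... | no ¬d = ⊥-elim (¬U (trans (round-active G k (state G k i) u) (∧-intro Uu (not-intro ¬d))))

  chosen-keep : ∀ {i j} u v → i ≤ j → E i u v ≡ true → E j u v ≡ true
  chosen-keep {i} {zero}  u v z≤n e = e
  chosen-keep {i} {suc j} u v i≤  e with m≤n⇒m<n∨m≡n i≤
  ... | inj₂ refl = e
  ... | inj₁ i<   = trans (round-edge G k (state G k j) u v) (∨-introˡ (chosen-keep u v (s≤s⁻¹ i<) e))

  chosen-new : ∀ i u {c} → U i ∋ u → c ∈ˡ centres i u → E (suc i) u (parent G u c) ≡ true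
  chosen-new i u {c} Uu c∈ = trans (round-edge G k (state G k i) u (parent G u c))
    (∨-introʳ (E i u (parent G u c)) (∧-intro Uu (isParent-complete G k u (proj₂ (sep i u)) c∈)))

  chosen-sound : ∀ i u v → E i u v ≡ true → ∃[ j ] (U j ∋ u × v ∈ˡ map (parent G u) (centres j u))
  chosen-sound (suc i) u v e with ∨-elim (E i u v) (trans (sym (round-edge G k (state G k i) u v)) e)
  ... | inj₁ e′ = chosen-sound i u v e′
  ... | inj₂ e′ with ∧-elim {U i u} e′
  ...   | Uu , e″ = i , Uu , isParent-sound G k u v (proj₂ (sep i u)) e″

  -- Every vertex computes the separator of its own component; within one component the inputs are
  -- pointwise equal, so all its vertices agree on the disks.
  sep-same : ∀ i {u v ℓ} → Inside G (U i ∋_) u v ℓ → sep i u ≡ sep i v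
  sep-same i p = separator-cong G k (component-cong G (U i) p)

  spanner : Graph n₁
  spanner .adj u v = if adj G u v then (if E n₁ u v then true else E n₁ v u) else false
  spanner .adj-sym u v rewrite adj-sym G u v with adj G v u | E n₁ u v | E n₁ v u
  ... | false | _     | _     = refl
  ... | true  | false | false = refl
  ... | true  | false | true  = refl
  ... | true  | true  | false = refl
  ... | true  | true  | true  = refl
  spanner .adj-irrefl u rewrite adj-irrefl G u = refl

  spanner-output : output (program (spannerᵉ k)) G ≡ matrix spanner
  spanner-output = trans (output-program G (spannerᵉ k))
    (tabulate-cong (λ u → tabulate-cong (λ v → spanner-correct G k u v)))

  spanner-new : ∀ i u {c} → i < n₁ → U i ∋ u → c ∈ˡ centres i u → Adj G u (parent G u c) →
                Adj spanner u (parent G u c)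
  spanner-new i u {c} i<n Uu c∈ e =
    ∧-intro e (∨-introˡ (chosen-keep u (parent G u c) i<n (chosen-new i u Uu c∈)))

  Shorter : Fin n₁ → Fin n₁ → ℕ → Set
  Shorter u v ℓ = ∃[ ℓ′ ] (ℓ′ ≤ ℓ × Walk spanner u v ℓ′)

  -- A walk split at a vertex removed before round i, the form in which `reroute` goes by induction
  -- on i.
  data Through (i : ℕ) (u v : Fin n₁) (ℓ : ℕ) : Set where
    through : ∀ {x a b} → Walk G u x a → Walk G x v b → a + b ≤ ℓ → ¬ U i ∋ x → Through i u v ℓ

  flip : ∀ {i u v ℓ} → Through i u v ℓ → Through i v u ℓ
  flip (through {a = a} {b} p q le ¬U) =
    through (reverse q) (reverse p) (≤-trans (≤-reflexive (+-comm b a)) le) ¬U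

  extend : ∀ {i u v w ℓ ℓ′} → Through i u v ℓ → Walk G v w ℓ′ → Through i u w (ℓ + ℓ′)
  extend {ℓ′ = ℓ′} (through {a = a} {b} p q le ¬U) r =
    through p (q ▹ r) (≤-trans (≤-reflexive (sym (+-assoc a b ℓ′))) (+-monoˡ-≤ ℓ′ le)) ¬U

  relax : ∀ {i u v ℓ ℓ′} → ℓ ≤ ℓ′ → Through i u v ℓ → Through i u v ℓ′
  relax ≤ℓ′ (through p q le ¬U) = through p q (≤-trans le ≤ℓ′) ¬U

  stays-or-exits : ∀ i {u v ℓ} → Walk G u v ℓ → Inside G (U i ∋_) u v ℓ ⊎ Through i u v ℓ
  stays-or-exits i {u} p with U i u Bool.≟ true
  ... | no ¬Uu = inj₂ (through [] p ≤-refl ¬Uu)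
  stays-or-exits i [] | yes Uu = inj₁ (stay Uu)
  stays-or-exits i (e ∷ p) | yes Uu with stays-or-exits i p
  ... | inj₁ q = inj₁ (step Uu e q)
  ... | inj₂ (through q r le ¬U) = inj₂ (through (e ∷ q) r (s≤s le) ¬U)

  -- A step to the parent uses up one unit of length and, while the parent is active, stays in the
  -- component, so c remains a centre. The number `b` bounds the recursion, since the walk from the
  -- parent is not a part of the given one.
  descend : ∀ i → i < n₁ → ∀ b {u c ℓ} → U i ∋ u → c ∈ˡ centres i u → Walk G u c ℓ → ℓ ≤ b →
            Shorter u c ℓ ⊎ Through i u c ℓ
  descend i i<n b Uu c∈ [] _ = inj₁ (0 , z≤n , [])
  descend i i<n (suc b) {u} {c} Uu c∈ (e ∷ p) (s≤s ≤b) with parent-spec G u c e p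
  ... | uy , ℓ′ , ≤ℓ , q with U i (parent G u c) Bool.≟ true
  ...   | no ¬Uy = inj₂ (through (uy ∷ []) q (s≤s ≤ℓ) ¬Uy)
  ...   | yes Uy with descend i i<n b Uy
                        (subst (λ s → c ∈ˡ toList k (proj₂ s)) (sep-same i (step Uu uy (stay Uy))) c∈)
                        q (≤-trans ≤ℓ ≤b)
  ...     | inj₁ (ℓ″ , ≤ℓ′ , r) =
    inj₁ (suc ℓ″ , s≤s (≤-trans ≤ℓ′ ≤ℓ) , spanner-new i u i<n Uu c∈ uy ∷ r)
  ...     | inj₂ (through r r′ le ¬U) = inj₂ (through (uy ∷ r) r′ (s≤s (≤-trans le ≤ℓ)) ¬U)

  module _ {t : ℕ} (good : ∀ C → Balanced G k C (separator G k C) × toℕ (proj₁ (separator G k C)) ≤ t) where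

    -- The component of v in round i + 1 lies in one component of what the disks leave of its
    -- component in round i, and balance bounds that by half.
    halving : ∀ i v → U i ∋ v → 2 ^ i * count (component G (U i) v) ≤ n₁
    halving zero    v Uv = ≤-trans (≤-reflexive (+-identityʳ _)) (count-≤ (component G (U 0) v))
    halving (suc i) v Uv = begin
      2 ^ suc i * count (component G (U (suc i)) v)    ≡⟨ cong (_* count (component G (U (suc i)) v)) (*-comm 2 (2 ^ i)) ⟩
      2 ^ i * 2 * count (component G (U (suc i)) v)    ≡⟨ *-assoc (2 ^ i) 2 _ ⟩
      2 ^ i * (2 * count (component G (U (suc i)) v))  ≤⟨ *-monoʳ-≤ (2 ^ i) (*-monoʳ-≤ 2 (count-mono _ _ inside)) ⟩
      2 ^ i * (2 * count (component G R v))            ≤⟨ *-monoʳ-≤ (2 ^ i) (proj₁ (good C) v Rv) ⟩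
      2 ^ i * count C                                  ≤⟨ halving i v (proj₁ (active-sound i v Uv)) ⟩
      n₁                                               ∎
      where
      open ≤-Reasoning
      C R : Fin n₁ → Bool
      C = component G (U i) v
      R = rest G k C (sep i v)
      in-rest : ∀ {x ℓ} → U (suc i) ∋ x → Inside G (U (suc i) ∋_) x v ℓ → R ∋ x
      in-rest {x} Ux p = rest-complete G k C (sep i v) (component-complete G (U i) v p′)
        (λ d → proj₂ (active-sound i x Ux) (subst (λ s → InDisks G k s x) (sym (sep-same i p′)) d))
        where p′ = weaken (λ {y} Uy → proj₁ (active-sound i y Uy)) p
      Rv : R ∋ v
      Rv = in-rest Uv (stay Uv)
      inside : ∀ u → component G (U (suc i)) v ∋ u → component G R v ∋ u
      inside u e = component-complete G R v
        (weaken (λ (Ux , _ , p) → in-rest Ux p) (trace (proj₂ (component-sound G (U (suc i)) v u e))))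

    -- A component halved i times still contains v. This limits both the rounds that cost stretch
    -- and those that add edges.
    active-level : ∀ i v → U i ∋ v → i ≤ ⌊log₂ n₁ ⌋
    active-level i v Uv = log-lower (begin
      2 ^ i                                ≡⟨ *-identityʳ (2 ^ i) ⟨
      2 ^ i * 1                            ≤⟨ *-monoʳ-≤ (2 ^ i) (count-positive (component G (U i) v)
                                                (component-complete G (U i) v (stay Uv))) ⟩
      2 ^ i * count (component G (U i) v)  ≤⟨ halving i v Uv ⟩
      n₁                                   ∎)
      where open ≤-Reasoning

    reassociate : ∀ i L {u v} → Shorter u v (L + 2 * t + i * (2 * t)) → Shorter u v (L + suc i * (2 * t))
    reassociate i L (ℓ , ≤ℓ , w) = ℓ , ≤-trans ≤ℓ (≤-reflexive (+-assoc L (2 * t) (i * (2 * t)))) , w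

    -- A walk of active vertices that meets a vertex x removed in round i is
    -- rerouted through a centre c near x.  If a descent to c leaves the active
    -- vertices, the rerouted walk meets a vertex removed in an earlier round.
    reroute : ∀ i → i ≤ n₁ → ∀ {u v L} → Through i u v L → Shorter u v (L + i * (2 * t))
    reroute zero    _   (through _ _ _ ¬U) = ⊥-elim (¬U refl)
    reroute (suc i) i<n {u} {v} {L} (through {x} {a} {b} p q le ¬Ux)
      with stays-or-exits i p | stays-or-exits i q
    -- A half that already meets a vertex removed earlier is passed to the previous rounds without
    -- spending the 2t of this one.
    ... | inj₂ p′ | _       = reassociate i L (reroute i (<⇒≤ i<n)
      (relax (≤-trans le (m≤m+n L (2 * t))) (extend p′ q)))
    ... | inj₁ _  | inj₂ q′ = reassociate i L (reroute i (<⇒≤ i<n)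
      (relax (≤-trans (≤-reflexive (+-comm b a)) (≤-trans le (m≤m+n L (2 * t)))) (flip (extend (flip q′) (reverse p)))))
    ... | inj₁ p′ | inj₁ q′ with removed i x (target p′) ¬Ux
    ...   | c , c∈ , near with ball-sound G c _ x near
    ...     | ℓ₀ , ≤r , s = result
      where
      ℓ₀≤t : ℓ₀ ≤ t
      ℓ₀≤t = ≤-trans ≤r (proj₂ (good (component G (U i) x)))

      -- The detour leads from x to the centre and back, each way of length at most the radius.
      total : (a + ℓ₀) + (b + ℓ₀) ≤ L + 2 * t
      total = begin
        (a + ℓ₀) + (b + ℓ₀)  ≡⟨ interchange a ℓ₀ b ℓ₀ ⟩
        (a + b) + (ℓ₀ + ℓ₀)  ≤⟨ +-mono-≤ le (+-mono-≤ ℓ₀≤t (≤-trans ℓ₀≤t (≤-reflexive (sym (+-identityʳ t))))) ⟩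
        L + 2 * t            ∎
        where open ≤-Reasoning

      result : Shorter u v (L + suc i * (2 * t))
      result with descend i i<n _ (source p′) (subst (λ s → c ∈ˡ toList k (proj₂ s)) (sym (sep-same i p′)) c∈) (p ▹ s) ≤-refl
                | descend i i<n _ (target q′) (subst (λ s → c ∈ˡ toList k (proj₂ s)) (sep-same i q′) c∈) (reverse q ▹ s) ≤-refl
      ... | inj₂ th | _ =
        reassociate i L (reroute i (<⇒≤ i<n) (relax total (extend th (reverse (reverse q ▹ s)))))
      ... | inj₁ _ | inj₂ th =
        reassociate i L (reroute i (<⇒≤ i<n)
          (relax (≤-trans (≤-reflexive (+-comm (b + ℓ₀) (a + ℓ₀))) total) (flip (extend th (reverse (p ▹ s))))))
      ... | inj₁ (ℓ₁ , ≤₁ , w₁) | inj₁ (ℓ₂ , ≤₂ , w₂) =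
        ℓ₁ + ℓ₂ , ≤-trans (+-mono-≤ ≤₁ ≤₂) (≤-trans total (+-monoʳ-≤ L (m≤m+n (2 * t) (i * (2 * t))))) , w₁ ▹ reverse w₂

    spanner-stretch : ∀ {ρ} → t ≤ ρ → AdditiveSpanner (additiveError ρ n₁) G spanner
    spanner-stretch t≤ρ .AdditiveSpanner.subgraph u v e = proj₁ (∧-elim {adj G u v} e)
    spanner-stretch {ρ} t≤ρ .AdditiveSpanner.stretch u v d (p , _) =
      -- After 1 + ⌊log₂ n⌋ rounds no vertex is active, so the walk may be split at its first vertex
      -- u.
      let ℓ , ≤ℓ , w  = reroute (suc ⌊log₂ n₁ ⌋) (log<n n₁ (s≤s z≤n))
                          (through [] p ≤-refl λ Uu → 1+n≰n (active-level (suc ⌊log₂ n₁ ⌋) u Uu))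
          d′ , dist , d′≤ℓ = distance w
      in d′ , dist , ≤-trans d′≤ℓ (≤-trans ≤ℓ (+-monoʳ-≤ d
           (≤-trans (*-monoʳ-≤ (suc ⌊log₂ n₁ ⌋) (*-monoʳ-≤ 2 t≤ρ)) (log-error ρ n₁ (s≤s z≤n)))))

    -- Counting edges.

    vertexEdges : ℕ → Fin n₁ → List (Fin n₁ × Fin n₁)
    vertexEdges j u = map (λ c → u , parent G u c) (centres j u)

    roundEdges : ℕ → List (Fin n₁ × Fin n₁)
    roundEdges j = concatMap (vertexEdges j) (allFin n₁)

    -- Inactive vertices are listed as well, which makes the length an exact product.
    candidates : List (Fin n₁ × Fin n₁)
    candidates = concatMap roundEdges (upTo (suc ⌊log₂ n₁ ⌋))

    length-candidates : length candidates ≡ suc ⌊log₂ n₁ ⌋ * (n₁ * k)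
    length-candidates = trans (length-concatMap roundEdges (n₁ * k) per-round (upTo (suc ⌊log₂ n₁ ⌋)))
      (cong (_* (n₁ * k)) (length-upTo (suc ⌊log₂ n₁ ⌋)))
      where
      per-round : ∀ j → length (roundEdges j) ≡ n₁ * k
      per-round j = trans
        (length-concatMap (vertexEdges j) k
          (λ u → trans (length-map _ (centres j u)) (length-toList k (proj₂ (sep j u)))) (allFin n₁))
        (cong (_* k) (length-tabulate {n = n₁} id))

    chosen-candidate : ∀ u v → E n₁ u v ≡ true → (u , v) ∈ˡ candidates
    chosen-candidate u v e with chosen-sound n₁ u v e
    ... | j , Uu , v∈ with ∈-map⁻ (parent G u) v∈
    ...   | c , c∈ , refl = ∈-concatMap⁺ roundEdges (lose (∈-upTo⁺ (s≤s (active-level j u Uu)))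
      (∈-concatMap⁺ (vertexEdges j) (lose (∈-allFin u) (∈-map⁺ (λ c → u , parent G u c) c∈))))

    spanner-edges : ∣E spanner ∣ ≤ 2 * (suc ⌊log₂ n₁ ⌋ * (n₁ * k))
    spanner-edges = begin
      length (edges spanner)                            ≤⟨ unique-length-≤ unique covered ⟩
      -- An edge may have been chosen from either end, whence the swapped copy and the factor 2.
      length (candidates ++ map swap candidates)        ≡⟨ length-++ candidates ⟩
      length candidates + length (map swap candidates)  ≡⟨ cong (length candidates +_) (length-map swap candidates) ⟩
      length candidates + length candidates             ≡⟨ cong (length candidates +_) (+-identityʳ _) ⟨
      2 * length candidates                             ≡⟨ cong (2 *_) length-candidates ⟩
      2 * (suc ⌊log₂ n₁ ⌋ * (n₁ * k))                   ∎
      where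
      open ≤-Reasoning
      edge? : (e : Fin n₁ × Fin n₁) → Dec (proj₁ e F.< proj₂ e × Adj spanner (proj₁ e) (proj₂ e))
      edge? (u , v) = (u F.<? v) ×-dec (adj spanner u v Bool.≟ true)
      unique : Unique (edges spanner)
      unique = Unique.filter⁺ edge? (Unique.cartesianProduct⁺ (Unique.allFin⁺ n₁) (Unique.allFin⁺ n₁))
      covered : ∀ {e} → e ∈ˡ edges spanner → e ∈ˡ candidates ++ map swap candidates
      covered {u , v} e∈ with ∈-filter⁻ edge? {xs = cartesianProduct (allFin n₁) (allFin n₁)} e∈
      ... | _ , _ , e with ∨-elim (E n₁ u v) (proj₂ (∧-elim {adj G u v} e))
      ...   | inj₁ uv = ∈-++⁺ˡ (chosen-candidate u v uv)
      ...   | inj₂ vu = ∈-++⁺ʳ candidates (∈-map⁺ swap (chosen-candidate v u vu))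

edge-count : ∀ k m {H : Graph (suc m)} → ∣E H ∣ ≤ 2 * (suc ⌊log₂ suc m ⌋ * (suc m * k)) →
             ∣E H ∣ ≤ 4 * (k * suc m * ⌊log₂ suc m ⌋)
-- For n = 1 the bound is 0, and a single vertex carries no edge.
edge-count k zero    _  = z≤n
edge-count k (suc m) le = ≤-trans le (begin
  -- From n = 2 on, 1 + L ≤ 2L; with the factor 2 for the two directions this gives the constant 4.
  2 * (suc L * (n′ * k))      ≤⟨ *-monoʳ-≤ 2 (*-monoˡ-≤ (n′ * k) (+-monoˡ-≤ L 1≤L)) ⟩
  2 * ((L + L) * (n′ * k))    ≡⟨ cong (λ x → 2 * ((L + x) * (n′ * k))) (+-identityʳ L) ⟨
  2 * (2 * L * (n′ * k))      ≡⟨ cong (2 *_) (*-assoc 2 L (n′ * k)) ⟩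
  2 * (2 * (L * (n′ * k)))    ≡⟨ *-assoc 2 2 (L * (n′ * k)) ⟨
  4 * (L * (n′ * k))          ≡⟨ cong (4 *_) (trans (*-comm L (n′ * k)) (cong (_* L) (*-comm n′ k))) ⟩
  4 * (k * n′ * L)            ∎)
  where
  open ≤-Reasoning
  n′ = suc (suc m)
  L = ⌊log₂ n′ ⌋
  1≤L : 1 ≤ L
  1≤L = log-lower {1} {n′} (s≤s (s≤s z≤n))

theorem6 : ∃[ C ] ((k : ℕ) → 1 ≤ k →
    Σ[ P ∈ Program ] ∃[ a ] ∃[ b ]
    ((ρ n : ℕ) .{{_ : NonZero n}} (G : Graph n) → Connected G →
    (t : ℕ) → IsTreeBreadth k G t → t ≤ ρ →
    Σ[ H ∈ Graph n ]
    ( AdditiveSpanner (additiveError ρ n) G H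
    × ∣E H ∣ ≤ C * (k * n * ⌊log₂ n ⌋)
    × output P G ≡ matrix H
    × time P G ≤ a * n ^ b )))
theorem6 = 4 , λ k _ →
  let a , b , poly = poly-bound (programBound (spannerᵉ k))
  in program (spannerᵉ k) , a , b , λ { ρ (suc m) G _ t ((D , (covered , _)) , _) t≤ρ →
       -- The decomposition only shows that a balanced tuple of radius at most t exists; the
       -- exhaustive search then finds one of no larger radius.
       let good : ∀ C → Balanced G k C (separator G k C) × toℕ (proj₁ (separator G k C)) ≤ t
           good C = let s , ok , s≤t = balanced-exists G k D covered C
                        ok′ , ≤s     = separator-spec G k C s ok
                    in ok′ , ≤-trans ≤s s≤t
       in spanner G k
        , spanner-stretch G k good t≤ρ
        , edge-count k m {spanner G k} (spanner-edges G k good)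
        , spanner-output G k
        , ≤-trans (time-program G (spannerᵉ k)) (poly (suc m)) }
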